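{- Let $L/\mathbb{F}_q$ be a field extension, $\Sigma\subset\mathbb{N}^*$ a finite set, $\delta_i:A\to L$ ($i\in\Sigma$) and $\gamma:A\to L$ injective $\mathbb{F}_q$-linear maps. Let $\sigma,\psi$ be two semi-characters and $m,n$ two positive integers. For all semi-characters $\alpha,\beta$ with $\alpha\beta=\sigma\psi$ and all integers $i,j\ge1$ with $i+j=m+n$ there is an element $f_{\alpha,\beta,i,j}\in\mathbb{F}_p$ (independent of $d$) such that for all $d\ge0$, $$S_d\begin{pmatrix} \sigma \\ m \end{pmatrix}S_d\begin{pmatrix} \psi \\ n \end{pmatrix}-S_d\begin{pmatrix} \sigma\psi \\ m+n \end{pmatrix}=\sum_{\substack{\alpha\beta=\sigma\psi \\ i+j=m+n}}f_{\alpha,\beta,i,j}\,S_d\begin{pmatrix} \alpha & \beta \\ i & j \end{pmatrix}.$$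
   Context: $q$ is a power of a prime $p$, $A=\mathbb{F}_q[\theta]$, $A^+$ the set of monic polynomials of $A$. Write $\gamma_a=\gamma(a)$. A semi-character is a map $A\to L$ of the form $a\mapsto\prod_{i\in\Sigma}\delta_i(a)^{\alpha_i}$ with $\alpha_i\in\mathbb{N}$; semi-characters are treated as formal monomials in the $\delta_i$, so that $\alpha\beta=\sigma\psi$ means that the exponent vectors of $\alpha$ and $\beta$ add up to that of $\sigma\psi$ (in particular the sum in the claim is finite). For semi-characters $\sigma_1,\dots,\sigma_r$, integers $n_1,\dots,n_r\ge1$ and $d\ge0$, $$S_d\begin{pmatrix} \sigma_1 & \cdots & \sigma_r \\ n_1 & \cdots & n_r \end{pmatrix}=\sum\frac{\sigma_1(a_1)\cdots\sigma_r(a_r)}{\gamma_{a_1}^{n_1}\cdots\gamma_{a_r}^{n_r}}\in L,$$ the sum being over $a_1,\dots,a_r\in A^+$ with $d=\deg_\theta(a_1)>\deg_\theta(a_2)>\cdots>\deg_\theta(a_r)\ge0$. -}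

module Defs where

open import Level using (Level; _⊔_) renaming (suc to lsuc)
open import Algebra.Bundles using (CommutativeRing)
open import Algebra.Module.Bundles.Raw using (RawLeftModule)
import Algebra.Module.Morphism.Structures as ModuleMorphisms
import Algebra.Morphism.Structures as RingMorphisms
import Algebra.Properties.Monoid.Mult as Mult
import Algebra.Properties.Monoid.Sum as Sum
import Algebra.Properties.Semiring.Exp as Exp
open import Data.Fin.Base using (Fin; toℕ)
open import Data.List.Base as List
  using (List; []; _∷_; _++_; map; concatMap; cartesianProductWith; foldr; upTo)
open import Data.Nat.Base as ℕ using (ℕ; zero; suc; _∸_)
open import Data.Product using (Σ; ∃; _×_; _,_; proj₁; proj₂)
open import Data.Vec.Base as Vec using (Vec; []; _∷_)
open import Function.Bundles using (Inverse)
open import Relation.Nullary using (¬_)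
open import Relation.Binary.PropositionalEquality as ≡ using (_≡_)

record Field c ℓ : Set (lsuc (c ⊔ ℓ)) where
  field
    commutativeRing : CommutativeRing c ℓ

  open CommutativeRing commutativeRing public

  field
    1≉0     : ¬ (1# ≈ 0#)
    inverse : ∀ x → ¬ (x ≈ 0#) → ∃ λ y → x * y ≈ 1#

  inv : ∀ x → ¬ (x ≈ 0#) → Carrier
  inv x x≉0 = proj₁ (inverse x x≉0)

  open Exp semiring public using (_^_)
  open Mult +-monoid public using () renaming (_×_ to _·_)

  ∑ : ∀ {a} {B : Set a} → List B → (B → Carrier) → Carrier
  ∑ xs t = foldr (λ x s → t x + s) 0# xs

  ∏ : ∀ {n} → (Fin n → Carrier) → Carrier
  ∏ = Sum.sum *-monoid

HasOrder : ∀ {c ℓ} → Field c ℓ → ℕ → Set (c ⊔ ℓ)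
HasOrder F q = Inverse (≡.setoid (Fin q)) (Field.setoid F)

record FieldExtension {c ℓ c′ ℓ′} (F : Field c ℓ) (L : Field c′ ℓ′)
       : Set (c ⊔ ℓ ⊔ c′ ⊔ ℓ′) where
  private
    module F = Field F
    module L = Field L
  open RingMorphisms.RingMorphisms F.rawRing L.rawRing
  field
    embed              : F.Carrier → L.Carrier
    isRingHomomorphism : IsRingHomomorphism embed

  -- L as an F-vector space.
  rawLeftModule : RawLeftModule F.Carrier c′ ℓ′
  rawLeftModule = record
    { Carrierᴹ = L.Carrier
    ; _≈ᴹ_     = L._≈_
    ; _+ᴹ_     = L._+_
    ; _*ₗ_     = λ x y → embed x L.* y
    ; 0ᴹ       = L.0#
    ; -ᴹ_      = L.-_
    }

-- The F-vector space F[θ].  A polynomial is a list of coefficients, constant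
-- term first; lists that differ by trailing zeros are identified by _≈ᴾ_.
-- The product of F[θ] is not needed: semi-characters are built from maps that
-- are only F-linear.
module Polynomials {c ℓ} (F : Field c ℓ) where
  open Field F

  Poly : Set c
  Poly = List Carrier

  coeff : Poly → ℕ → Carrier
  coeff []       _       = 0#
  coeff (x ∷ _)  zero    = x
  coeff (_ ∷ xs) (suc n) = coeff xs n

  infix 4 _≈ᴾ_
  _≈ᴾ_ : Poly → Poly → Set ℓ
  f ≈ᴾ g = ∀ n → coeff f n ≈ coeff g n

  infixl 6 _+ᴾ_
  _+ᴾ_ : Poly → Poly → Poly
  []       +ᴾ ys       = ys
  (x ∷ xs) +ᴾ []       = x ∷ xs
  (x ∷ xs) +ᴾ (y ∷ ys) = (x + y) ∷ (xs +ᴾ ys)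

  rawLeftModule : RawLeftModule Carrier c ℓ
  rawLeftModule = record
    { Carrierᴹ = Poly
    ; _≈ᴹ_     = _≈ᴾ_
    ; _+ᴹ_     = _+ᴾ_
    ; _*ₗ_     = λ x → map (x *_)
    ; 0ᴹ       = []
    ; -ᴹ_      = map (-_)
    }

  -- (d , c₀ ∷ … ∷ c_{d-1}) is c₀ + c₁ θ + … + c_{d-1} θ^{d-1} + θ^d; every monic
  -- polynomial of degree d has exactly one such presentation, up to _≈_ on
  -- the coefficients.
  Monic : Set c
  Monic = Σ ℕ (Vec Carrier)

  poly : Monic → Poly
  poly (_ , cs) = Vec.toList cs ++ (1# ∷ [])

  monic≉0 : ∀ a → ¬ (poly a ≈ᴾ [])
  monic≉0 (d , cs) eq = 1≉0 (trans (sym (lead cs)) (eq d))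
    where
    lead : ∀ {d} (cs : Vec Carrier d) → coeff (Vec.toList cs ++ (1# ∷ [])) d ≈ 1#
    lead []       = refl
    lead (_ ∷ cs) = lead cs

  module Enumeration {q} (F-order : HasOrder F q) where

    elements : List Carrier
    elements = List.tabulate (Inverse.to F-order)

    vectors : ∀ d → List (Vec Carrier d)
    vectors zero    = [] ∷ []
    vectors (suc d) = cartesianProductWith _∷_ elements (vectors d)

    monics : ℕ → List Monic
    monics d = map (d ,_) (vectors d)

    -- All (a₁ , … , a_{r+1}) with d = deg a₁ > deg a₂ > … > deg a_{r+1} ≥ 0.
    chains : ∀ r → ℕ → List (Vec Monic (suc r))
    chains zero    d = map (_∷ []) (monics d)
    chains (suc r) d =
      cartesianProductWith _∷_ (monics d) (concatMap (λ e → chains r e) (upTo d))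

record InjectiveLinearMap {c ℓ c′ ℓ′} {F : Field c ℓ} {L : Field c′ ℓ′}
       (ext : FieldExtension F L) : Set (c ⊔ ℓ ⊔ c′ ⊔ ℓ′) where
  open Polynomials F using (Poly; Monic; poly; monic≉0)
  open ModuleMorphisms.LeftModuleMorphisms
    (Polynomials.rawLeftModule F) (FieldExtension.rawLeftModule ext)
  private module L = Field L
  field
    ⟦_⟧            : Poly → L.Carrier
    isMonomorphism : IsLeftModuleMonomorphism ⟦_⟧

  open IsLeftModuleMonomorphism isMonomorphism public

  ⟦monic⟧≉0 : ∀ a → ¬ (⟦ poly a ⟧ L.≈ L.0#)
  ⟦monic⟧≉0 a eq = monic≉0 a (injective (L.trans eq (L.sym 0ᴹ-homo)))

  ⟦_⟧⁻¹ : Monic → L.Carrier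
  ⟦ a ⟧⁻¹ = L.inv ⟦ poly a ⟧ (⟦monic⟧≉0 a)

-- Formal monomials in the δ_i, given by their exponent vectors.  The indices i
-- are only labels, so a finite index set Σ ⊂ ℕ* with s elements is numbered as Fin s.
SemiChar : ℕ → Set
SemiChar s = Vec ℕ s

infixl 7 _⊗_
_⊗_ : ∀ {s} → SemiChar s → SemiChar s → SemiChar s
_⊗_ = Vec.zipWith ℕ._+_

-- All (k , l) with k + l = n.
splittings : ℕ → List (ℕ × ℕ)
splittings n = map (λ k → k , n ∸ k) (upTo (suc n))

-- All (i , j) with i , j ≥ 1 and i + j = n.
positiveSplittings : ℕ → List (ℕ × ℕ)
positiveSplittings n = map (λ k → suc k , n ∸ suc k) (upTo (n ∸ 1))

-- All (α , β) with α ⊗ β = τ.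
factorizations : ∀ {s} → SemiChar s → List (SemiChar s × SemiChar s)
factorizations []      = ([] , []) ∷ []
factorizations (n ∷ τ) =
  cartesianProductWith (λ (k , l) (α , β) → (k ∷ α , l ∷ β)) (splittings n) (factorizations τ)

module PowerSums
  {c ℓ c′ ℓ′} {F : Field c ℓ} {L : Field c′ ℓ′}
  {q} (F-order : HasOrder F q) (ext : FieldExtension F L)
  {s} (δ : Fin s → InjectiveLinearMap ext) (γ : InjectiveLinearMap ext)
  where

  open Field L
  open Polynomials F
  open Enumeration F-order
  open InjectiveLinearMap

  eval : SemiChar s → Poly → Carrier
  eval α a = ∏ (λ i → ⟦ δ i ⟧ a ^ Vec.lookup α i)

  summand : ∀ {r} → Vec (SemiChar s) r → Vec ℕ r → Vec Monic r → Carrier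
  summand []       []       []       = 1#
  summand (σ ∷ σs) (n ∷ ns) (a ∷ as) = (eval σ (poly a) * ⟦ γ ⟧⁻¹ a ^ n) * summand σs ns as

  S : ∀ {r} → ℕ → Vec (SemiChar s) (suc r) → Vec ℕ (suc r) → Carrier
  S {r} d σs ns = ∑ (chains r d) (summand σs ns)

  -- 𝔽_p is represented by residues 0 , … , p-1, and k acts on L as k · 1; this
  -- is the inclusion of the prime field when L has characteristic p.
  residue : ∀ {p} → Fin p → Carrier
  residue k = toℕ k · 1#

{-# OPTIONS --safe #-}

-- Write u = a - b.  For a ≠ b the identity γ_a⁻¹ γ_b⁻¹ = γ_u⁻¹ (γ_b⁻¹ - γ_a⁻¹) gives a partial fraction
-- expansion of γ_a⁻ᵐ γ_b⁻ⁿ in the γ_a⁻ⁱ γ_u⁻ʲ and γ_b⁻ⁱ γ_u⁻ʲ with i, j ≥ 1 and integer coefficients, while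
-- linearity of the δ_i expands σ(a) ψ(b) in the α(a) β(u), and likewise in the α(b) β(u).  For fixed a, as
-- b runs over the monic polynomials of degree d, u runs over the polynomials of degree < d; a nonzero u is
-- uniquely λ c with λ ∈ F^× and c monic of degree < d, so the off-diagonal terms are multiples of
-- S_d(α β; i j) by Σ_λ λ^(|β| - j), which is 0 or -1.

module Submission where

open import Defs
open import Level using (Level)
import Algebra.Morphism.Structures as RingMorphisms
import Algebra.Properties.CommutativeMonoid.Sum as FinSum
import Algebra.Properties.CommutativeSemigroup as CommutativeSemigroupProperties
import Algebra.Properties.CommutativeSemiring.Exp as ExpProperties
import Algebra.Properties.Ring as RingProperties
import Algebra.Properties.Semiring.Mult as SemiringMult
import Algebra.Solver.Ring.NaturalCoefficients.Default as SemiringSolver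
open import Data.Fin.Base as Fin using (Fin; toℕ)
import Data.Fin.Properties as Fin
open import Data.List.Base as List
  using (List; []; _∷_; _++_; map; cartesianProduct; cartesianProductWith; concatMap; upTo; applyUpTo)
import Data.List.Properties as List
open import Data.Nat.Base as ℕ using (ℕ; zero; suc; _∸_; s≤s; z≤n)
import Data.Nat.DivMod as ℕ
open import Data.Nat.Primality using (Prime; ¬prime[0])
import Data.Nat.Properties as ℕ
open import Data.Product using (∃; ∃₂; _×_; _,_; proj₁; proj₂)
open import Data.Vec.Base as Vec using (Vec; []; _∷_)
open import Function.Base using (_∘_; case_of_)
open import Function.Bundles using (Inverse)
import Function.Construct.Composition as Composition
import Function.Construct.Symmetry as Symmetry
import Relation.Binary.Reasoning.Setoid as SetoidReasoning
open import Relation.Binary.PropositionalEquality as ≡ using (_≡_)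
open import Relation.Nullary using (¬_; Dec; yes; no; contradiction; ¬?; _×-dec_; map′)
open import Relation.Nullary.Decidable using (decidable-stable)

-- The coefficients must lie in the prime field and be fixed before d, a and b are given. Every
-- coefficient is therefore carried as a natural number n acting through `ι n`, with -1 written as
-- the predecessor of the characteristic, and is reduced modulo the characteristic only at the very
-- end. Partial fractions make sense only for a ≠ b, whereas replacing b by u requires b to run over
-- all monic polynomials of degree d. Setting the reciprocal of 0 to 0 removes the conflict: the
-- reciprocal of u always occurs with exponent at least 1, so pairs with a = b contribute nothing to
-- the off-diagonal part, and an indicator of u = 0 collects the diagonal into S_d(σψ; m+n).
-- Elements of F and polynomials are given only up to an equivalence, so every function that is
-- summed after a change of variable has to respect it.

private variable
  o : Level
  A B C : Set o

-- Finite sums with values in a field.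

module FieldSums {c ℓ} (K : Field c ℓ) where
  open Field K
  open SetoidReasoning setoid
  open CommutativeSemigroupProperties +-commutativeSemigroup using (interchange)

  ∑-cong : (xs : List A) {f g : A → Carrier} → (∀ x → f x ≈ g x) → ∑ xs f ≈ ∑ xs g
  ∑-cong []       f≈g = refl
  ∑-cong (x ∷ xs) f≈g = +-cong (f≈g x) (∑-cong xs f≈g)

  ∑-zero : (xs : List A) {f : A → Carrier} → (∀ x → f x ≈ 0#) → ∑ xs f ≈ 0#
  ∑-zero []       f≈0 = refl
  ∑-zero (x ∷ xs) f≈0 = trans (+-cong (f≈0 x) (∑-zero xs f≈0)) (+-identityˡ 0#)

  ∑-distrib-+ : (xs : List A) (f g : A → Carrier) →
                ∑ xs (λ x → f x + g x) ≈ ∑ xs f + ∑ xs g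
  ∑-distrib-+ []       f g = sym (+-identityˡ 0#)
  ∑-distrib-+ (x ∷ xs) f g =
    trans (+-congˡ (∑-distrib-+ xs f g)) (interchange _ _ _ _)

  *-distribˡ-∑ : ∀ k (xs : List A) (f : A → Carrier) → k * ∑ xs f ≈ ∑ xs (λ x → k * f x)
  *-distribˡ-∑ k []       f = zeroʳ k
  *-distribˡ-∑ k (x ∷ xs) f = trans (distribˡ k _ _) (+-congˡ (*-distribˡ-∑ k xs f))

  *-distribʳ-∑ : ∀ k (xs : List A) (f : A → Carrier) → ∑ xs f * k ≈ ∑ xs (λ x → f x * k)
  *-distribʳ-∑ k []       f = zeroˡ k
  *-distribʳ-∑ k (x ∷ xs) f = trans (distribʳ k _ _) (+-congˡ (*-distribʳ-∑ k xs f))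

  ∑-++ : (xs ys : List A) (f : A → Carrier) → ∑ (xs ++ ys) f ≈ ∑ xs f + ∑ ys f
  ∑-++ []       ys f = sym (+-identityˡ _)
  ∑-++ (x ∷ xs) ys f = trans (+-congˡ (∑-++ xs ys f)) (sym (+-assoc _ _ _))

  ∑-map : (h : A → B) (xs : List A) (f : B → Carrier) → ∑ (map h xs) f ≈ ∑ xs (f ∘ h)
  ∑-map h []       f = refl
  ∑-map h (x ∷ xs) f = +-congˡ (∑-map h xs f)

  ∑-concatMap : (h : A → List B) (xs : List A) (f : B → Carrier) →
                ∑ (concatMap h xs) f ≈ ∑ xs (λ x → ∑ (h x) f)
  ∑-concatMap h []       f = refl
  ∑-concatMap h (x ∷ xs) f = trans (∑-++ (h x) _ f) (+-congˡ (∑-concatMap h xs f))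

  ∑-cartesianProductWith : (h : A → B → C) (xs : List A) (ys : List B) (f : C → Carrier) →
                           ∑ (cartesianProductWith h xs ys) f ≈ ∑ xs (λ x → ∑ ys (λ y → f (h x y)))
  ∑-cartesianProductWith h []       ys f = refl
  ∑-cartesianProductWith h (x ∷ xs) ys f =
    trans (∑-++ (map (h x) ys) _ f)
          (+-cong (∑-map (h x) ys f) (∑-cartesianProductWith h xs ys f))

  ∑-comm : (xs : List A) (ys : List B) (f : A → B → Carrier) →
           ∑ xs (λ x → ∑ ys (f x)) ≈ ∑ ys (λ y → ∑ xs (λ x → f x y))
  ∑-comm []       ys f = sym (∑-zero ys (λ _ → refl))
  ∑-comm (x ∷ xs) ys f =
    trans (+-congˡ (∑-comm xs ys f)) (sym (∑-distrib-+ ys (f x) _))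

  ∑-*-∑ : (xs : List A) (ys : List B) (f : A → Carrier) (g : B → Carrier) →
          ∑ xs f * ∑ ys g ≈ ∑ xs (λ x → ∑ ys (λ y → f x * g y))
  ∑-*-∑ xs ys f g =
    trans (*-distribʳ-∑ _ xs f) (∑-cong xs (λ x → *-distribˡ-∑ (f x) ys g))

  ∑-applyUpTo : (h : ℕ → B) (n : ℕ) (f : B → Carrier) → ∑ (applyUpTo h n) f ≈ ∑ (upTo n) (f ∘ h)
  ∑-applyUpTo h n f =
    trans (reflexive (≡.cong (λ ys → ∑ ys f) (≡.sym (List.map-upTo h n)))) (∑-map h (upTo n) f)

  -- Multiplying a form of degree n by w raises every k by one and leaves only the splitting with k
  -- = 0 uncovered. Multiplying by u does the same with l, and `∑-splittings-sucʳ` peels off the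
  -- opposite end.
  ∑-splittings-suc : ∀ n (f : ℕ × ℕ → Carrier) →
    ∑ (splittings (suc n)) f ≈ f (0 , suc n) + ∑ (splittings n) (λ (k , l) → f (suc k , l))
  ∑-splittings-suc n f = +-congˡ (begin
    ∑ (map _ (applyUpTo suc (suc n))) f                 ≈⟨ ∑-map _ (applyUpTo suc (suc n)) f ⟩
    ∑ (applyUpTo suc (suc n)) (λ k → f (k , suc n ∸ k)) ≈⟨ ∑-applyUpTo suc (suc n) _ ⟩
    ∑ (upTo (suc n)) (λ k → f (suc k , n ∸ k))          ≈⟨ ∑-map _ (upTo (suc n)) _ ⟨
    ∑ (splittings n) (λ (k , l) → f (suc k , l))        ∎)

  ∑-splittings-sucʳ : ∀ n (f : ℕ × ℕ → Carrier) →
    ∑ (splittings (suc n)) f ≈ ∑ (splittings n) (λ (k , l) → f (k , suc l)) + f (suc n , 0)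
  ∑-splittings-sucʳ zero    f = trans (+-congˡ (+-identityʳ _)) (+-congʳ (sym (+-identityʳ _)))
  ∑-splittings-sucʳ (suc n) f = begin
    ∑ (splittings (suc (suc n))) f
      ≈⟨ ∑-splittings-suc (suc n) f ⟩
    f (0 , suc (suc n)) + ∑ (splittings (suc n)) (λ (k , l) → f (suc k , l))
      ≈⟨ +-congˡ (∑-splittings-sucʳ n _) ⟩
    f (0 , suc (suc n)) + (∑ (splittings n) (λ (k , l) → f (suc k , suc l)) + f (suc (suc n) , 0))
      ≈⟨ +-assoc _ _ _ ⟨
    f (0 , suc (suc n)) + ∑ (splittings n) (λ (k , l) → f (suc k , suc l)) + f (suc (suc n) , 0)
      ≈⟨ +-congʳ (∑-splittings-suc n (λ (k , l) → f (k , suc l))) ⟨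
    ∑ (splittings (suc n)) (λ (k , l) → f (k , suc l)) + f (suc (suc n) , 0) ∎

  -- Forms are indexed by exponents starting at 0, the power sums of the theorem by i, j ≥ 1. This
  -- shift by one in each exponent connects the two.
  ∑-positiveSplittings : ∀ n (f : ℕ × ℕ → Carrier) →
    ∑ (positiveSplittings (suc (suc n))) f ≈ ∑ (splittings n) (λ (k , l) → f (suc k , suc l))
  ∑-positiveSplittings zero    f = refl
  ∑-positiveSplittings (suc n) f = begin
    ∑ (positiveSplittings (3 ℕ.+ n)) f
      ≈⟨ +-congˡ (∑-map _ (applyUpTo suc (suc n)) f) ⟩
    f (1 , suc (suc n)) + ∑ (applyUpTo suc (suc n)) (λ k → f (suc k , suc (suc n) ∸ k))
      ≈⟨ +-congˡ (∑-applyUpTo suc (suc n) _) ⟩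
    f (1 , suc (suc n)) + ∑ (upTo (suc n)) (λ k → f (suc (suc k) , suc n ∸ k))
      ≈⟨ +-congˡ (∑-map _ (upTo (suc n)) _) ⟨
    f (1 , suc (suc n)) + ∑ (positiveSplittings (suc (suc n))) (λ (k , l) → f (suc k , l))
      ≈⟨ +-congˡ (∑-positiveSplittings n _) ⟩
    f (1 , suc (suc n)) + ∑ (splittings n) (λ (k , l) → f (suc (suc k) , suc l))
      ≈⟨ ∑-splittings-suc n _ ⟨
    ∑ (splittings (suc n)) (λ (k , l) → f (suc k , suc l)) ∎

  ∑-tabulate : ∀ {n} (h : Fin n → A) (f : A → Carrier) →
               ∑ (List.tabulate h) f ≈ FinSum.sum +-commutativeMonoid (f ∘ h)
  ∑-tabulate {n = zero}  h f = refl
  ∑-tabulate {n = suc n} h f = +-congˡ (∑-tabulate (h ∘ Fin.suc) f)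

  ∑-const : (xs : List A) (x : Carrier) → ∑ xs (λ _ → x) ≈ List.length xs · x
  ∑-const []       x = refl
  ∑-const (_ ∷ xs) x = +-congˡ (∑-const xs x)

-- Change of variable in sums over a finite field.

module FiniteFieldSums {c ℓ c′ ℓ′} (F : Field c ℓ) {q} (F-order : HasOrder F q) (K : Field c′ ℓ′) where
  private module F = Field F
  open Polynomials.Enumeration F F-order using (elements)
  open Field K
  open FieldSums K
  open SetoidReasoning setoid
  open Inverse F-order

  -- Conjugating `φ` with the enumeration gives a permutation `π` of `Fin q`. The image under `φ` of
  -- a listed element is only equivalent to a listed one, so `h` must respect the equality of F.
  ∑-permute : (φ : Inverse F.setoid F.setoid) (h : F.Carrier → Carrier) →
              (∀ {x y} → x F.≈ y → h x ≈ h y) →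
              ∑ elements (h ∘ Inverse.to φ) ≈ ∑ elements h
  ∑-permute φ h h-cong = begin
    ∑ elements (h ∘ Inverse.to φ)  ≈⟨ ∑-tabulate to _ ⟩
    sum (h ∘ Inverse.to φ ∘ to)    ≈⟨ sum-cong-≋ {n = q} (λ i → h-cong (strictlyInverseˡ (Inverse.to φ (to i)))) ⟨
    sum (h ∘ to ∘ Inverse.to π)    ≈⟨ sum-permute (h ∘ to) π ⟨
    sum (h ∘ to)                   ≈⟨ ∑-tabulate to h ⟨
    ∑ elements h                   ∎
    where
    open FinSum +-commutativeMonoid using (sum; sum-cong-≋; sum-permute)
    π = Composition.inverse (Composition.inverse F-order φ) (Symmetry.inverse F-order)

-- Field arithmetic and the natural multiples of 1.

module FieldProperties {c ℓ} (K : Field c ℓ) where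
  open Field K
  open SetoidReasoning setoid
  open RingProperties ring public
    using (-‿distribˡ-*; [y-z]x≈yx-zx; -‿involutive; +-inverseʳ-unique; +-cancelˡ)
    renaming (x∙y⁻¹≈ε⇒x≈y to x-y≈0⇒x≈y; x≈y⇒x∙y⁻¹≈ε to x≈y⇒x-y≈0; ⁻¹-anti-homo‿- to -‿anti-homo‿-)
  open ExpProperties commutativeSemiring public using (^-distrib-*; ^-homo-*; ^-congˡ)
  open SemiringMult semiring public using (×-homo-+; ×1-homo-*)
  open CommutativeSemigroupProperties *-commutativeSemigroup public
    using () renaming (interchange to *-interchange; x∙yz≈y∙xz to x*yz≈y*xz)

  ι : ℕ → Carrier
  ι n = n · 1#

  ι-1 : ι 1 ≈ 1#
  ι-1 = +-identityʳ 1#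

  ι-+ : ∀ m n → ι (m ℕ.+ n) ≈ ι m + ι n
  ι-+ = ×-homo-+ 1#

  *-cancelˡ-zero : ∀ {x y} → ¬ (x ≈ 0#) → x * y ≈ 0# → y ≈ 0#
  *-cancelˡ-zero {x} {y} x≉0 xy≈0 = begin
    y                ≈⟨ *-identityˡ y ⟨
    1# * y           ≈⟨ *-congʳ (proj₂ (inverse x x≉0)) ⟨
    x * x⁻¹ * y      ≈⟨ *-congʳ (*-comm x x⁻¹) ⟩
    x⁻¹ * x * y      ≈⟨ *-assoc x⁻¹ x y ⟩
    x⁻¹ * (x * y)    ≈⟨ *-congˡ xy≈0 ⟩
    x⁻¹ * 0#         ≈⟨ zeroʳ x⁻¹ ⟩
    0#               ∎
    where x⁻¹ = inv x x≉0

  *-inverse-unique : ∀ {x y z} → x * y ≈ 1# → x * z ≈ 1# → y ≈ z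
  *-inverse-unique {x} {y} {z} xy≈1 xz≈1 = begin
    y            ≈⟨ *-identityʳ y ⟨
    y * 1#       ≈⟨ *-congˡ xz≈1 ⟨
    y * (x * z)  ≈⟨ *-assoc y x z ⟨
    y * x * z    ≈⟨ *-congʳ (trans (*-comm y x) xy≈1) ⟩
    1# * z       ≈⟨ *-identityˡ z ⟩
    z            ∎

  x*y≈1⇒x≉0 : ∀ {x y} → x * y ≈ 1# → ¬ (x ≈ 0#)
  x*y≈1⇒x≉0 xy≈1 x≈0 = 1≉0 (trans (sym xy≈1) (trans (*-congʳ x≈0) (zeroˡ _)))

  0^1+n≈0 : ∀ n → 0# ^ suc n ≈ 0#
  0^1+n≈0 n = zeroˡ _

-- Finite fields: characteristic and a total inverse.

module FiniteField {c ℓ} (F : Field c ℓ) {q} (F-order : HasOrder F q) where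
  open Field F
  open FieldProperties F
  open Polynomials.Enumeration F F-order using (elements)
  open FiniteFieldSums F F-order F
  open FieldSums F
  open Inverse F-order using (to; from; from-cong; strictlyInverseˡ; strictlyInverseʳ)
  open SetoidReasoning setoid

  infix 4 _≟_
  _≟_ : ∀ x y → Dec (x ≈ y)
  x ≟ y = map′ (λ eq → trans (sym (strictlyInverseˡ x)) (trans (reflexive (≡.cong to eq)) (strictlyInverseˡ y)))
               from-cong (from x Fin.≟ from y)

  translation : Carrier → Inverse setoid setoid
  translation x = record
    { to = x +_ ; from = - x +_ ; to-cong = +-congˡ ; from-cong = +-congˡ
    ; inverse = (λ eq → trans (+-congˡ eq) (cancel (-‿inverseʳ x)))
              , (λ eq → trans (+-congˡ eq) (cancel (-‿inverseˡ x)))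
    }
    where
    cancel : ∀ {y z w} → y + z ≈ 0# → y + (z + w) ≈ w
    cancel y+z≈0 = trans (sym (+-assoc _ _ _)) (trans (+-congʳ y+z≈0) (+-identityˡ _))

  negation : Inverse setoid setoid
  negation = record
    { to = -_ ; from = -_ ; to-cong = -‿cong ; from-cong = -‿cong
    ; inverse = (λ {y} eq → trans (-‿cong eq) (-‿involutive y))
              , (λ {y} eq → trans (-‿cong eq) (-‿involutive y))
    }

  scaling : ∀ x → ¬ (x ≈ 0#) → Inverse setoid setoid
  scaling x x≉0 = record
    { to = x *_ ; from = inv x x≉0 *_ ; to-cong = *-congˡ ; from-cong = *-congˡ
    ; inverse = (λ eq → trans (*-congˡ eq) (cancel x*x⁻¹≈1))
              , (λ eq → trans (*-congˡ eq) (cancel (trans (*-comm _ _) x*x⁻¹≈1)))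
    }
    where
    x*x⁻¹≈1 = proj₂ (inverse x x≉0)

    cancel : ∀ {y z w} → y * z ≈ 1# → y * (z * w) ≈ w
    cancel y*z≈1 = trans (sym (*-assoc _ _ _)) (trans (*-congʳ y*z≈1) (*-identityˡ _))

  -- Translation by 1 permutes F, so the sum of all elements does not change when 1 is added to each
  -- of the q summands.
  order·1≈0 : ι q ≈ 0#
  order·1≈0 = +-cancelˡ S _ _ (begin
    S + ι q                            ≈⟨ +-comm S _ ⟩
    ι q + S                            ≈⟨ +-congʳ (reflexive (≡.cong ι (List.length-tabulate to))) ⟨
    ι (List.length elements) + S       ≈⟨ +-congʳ (∑-const elements 1#) ⟨
    ∑ elements (λ _ → 1#) + S          ≈⟨ ∑-distrib-+ elements _ _ ⟨
    ∑ elements (λ y → 1# + y)          ≈⟨ ∑-permute (translation 1#) (λ y → y) (λ eq → eq) ⟩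
    S                                  ≈⟨ +-identityʳ S ⟨
    S + 0#                             ∎)
    where S = ∑ elements (λ y → y)

  -- There are no zero divisors, so the factors p · 1 can be cancelled one after another; if none of
  -- them vanished, 1 = 0 would remain. With `order·1≈0` this yields characteristic p from q = p^e.
  ι-^-zero : ∀ p e → ι (p ℕ.^ e) ≈ 0# → ι p ≈ 0#
  ι-^-zero p zero    eq = contradiction (trans (sym ι-1) eq) 1≉0
  ι-^-zero p (suc e) eq with ι p ≟ 0#
  ... | yes p≈0 = p≈0
  ... | no  p≉0 = ι-^-zero p e (*-cancelˡ-zero p≉0 (trans (sym (×1-homo-* p (p ℕ.^ e))) eq))

  -- Sums over all of F call for a total inverse. The value 0 at 0 keeps `inv₀ (x * y)`
  -- multiplicative when y vanishes.
  inv₀ : Carrier → Carrier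
  inv₀ x with x ≟ 0#
  ... | yes _   = 0#
  ... | no  x≉0 = inv x x≉0

  inv₀-zero : ∀ {x} → x ≈ 0# → inv₀ x ≈ 0#
  inv₀-zero {x} x≈0 with x ≟ 0#
  ... | yes _   = refl
  ... | no  x≉0 = contradiction x≈0 x≉0

  inv₀-inverse : ∀ {x} → ¬ (x ≈ 0#) → x * inv₀ x ≈ 1#
  inv₀-inverse {x} x≉0 with x ≟ 0#
  ... | yes x≈0 = contradiction x≈0 x≉0
  ... | no  x≉0 = proj₂ (inverse x x≉0)

  *-≉0 : ∀ {x y} → ¬ (x ≈ 0#) → ¬ (y ≈ 0#) → ¬ (x * y ≈ 0#)
  *-≉0 x≉0 y≉0 xy≈0 = y≉0 (*-cancelˡ-zero x≉0 xy≈0)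

  inv₀-cong : ∀ {x y} → x ≈ y → inv₀ x ≈ inv₀ y
  inv₀-cong {x} {y} x≈y with x ≟ 0#
  ... | yes x≈0 = sym (inv₀-zero (trans (sym x≈y) x≈0))
  ... | no  x≉0 = *-inverse-unique (proj₂ (inverse x x≉0))
                    (trans (*-congʳ x≈y) (inv₀-inverse (λ y≈0 → x≉0 (trans x≈y y≈0))))

  inv₀-* : ∀ {x y} → ¬ (x ≈ 0#) → inv₀ (x * y) ≈ inv₀ x * inv₀ y
  inv₀-* {x} {y} x≉0 with y ≟ 0#
  ... | yes y≈0 = trans (inv₀-zero (trans (*-congˡ y≈0) (zeroʳ x))) (sym (zeroʳ _))
  ... | no  y≉0 = *-inverse-unique (inv₀-inverse (*-≉0 x≉0 y≉0))
                    (trans (*-interchange x y _ _)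
                      (trans (*-cong (inv₀-inverse x≉0) (proj₂ (inverse y y≉0))) (*-identityˡ 1#)))

-- Sums over the nonzero elements.

module Nonzero {c ℓ c′ ℓ′} (F : Field c ℓ) {q} (F-order : HasOrder F q) (K : Field c′ ℓ′) where
  private module F = Field F
  open FiniteField F F-order using (_≟_)
  open Polynomials.Enumeration F F-order using (elements)
  open Field K
  open FieldSums K
  open FiniteFieldSums F F-order K
  open FinSum +-commutativeMonoid using (sum; sum-cong-≋)
  open Inverse F-order using (to; from; from-cong; strictlyInverseˡ; strictlyInverseʳ)
  open SetoidReasoning setoid

  -- A weight instead of a shorter list: a sum over F^× remains a sum over `elements`, to which
  -- `∑-permute` applies. The weight takes values in `K` because it is used with F and with L as
  -- target.
  nonzero : F.Carrier → Carrier
  nonzero x with x ≟ F.0#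
  ... | yes _ = 0#
  ... | no  _ = 1#

  nonzero-⇔ : ∀ {x y} → (x F.≈ F.0# → y F.≈ F.0#) → (y F.≈ F.0# → x F.≈ F.0#) → nonzero x ≈ nonzero y
  nonzero-⇔ {x} {y} x⇒y y⇒x with x ≟ F.0# | y ≟ F.0#
  ... | yes _   | yes _   = refl
  ... | no  _   | no  _   = refl
  ... | yes x≈0 | no  y≉0 = contradiction (x⇒y x≈0) y≉0
  ... | no  x≉0 | yes y≈0 = contradiction (y⇒x y≈0) x≉0

  nonzero-cong : ∀ {x y} → x F.≈ y → nonzero x ≈ nonzero y
  nonzero-cong x≈y = nonzero-⇔ (F.trans (F.sym x≈y)) (F.trans x≈y)

  -- Under the weight an identity has to hold only for x ≉ 0. In this way division by x enters sums
  -- over all elements.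
  nonzero-*-cong : ∀ x {k l} → (¬ (x F.≈ F.0#) → k ≈ l) → nonzero x * k ≈ nonzero x * l
  nonzero-*-cong x k≈l with x ≟ F.0#
  ... | yes _   = trans (zeroˡ _) (sym (zeroˡ _))
  ... | no  x≉0 = *-congˡ (k≈l x≉0)

  sum-single : ∀ {n} (i : Fin n) (t : Fin n → Carrier) → (∀ j → ¬ (j ≡ i) → t j ≈ 0#) → sum t ≈ t i
  sum-single {n = suc n} Fin.zero t t≈0 =
    trans (+-congˡ (trans (sum-cong-≋ {n = n} (λ j → t≈0 (Fin.suc j) (λ ()))) (FinSum.sum-replicate-zero +-commutativeMonoid n)))
          (+-identityʳ _)
  sum-single (Fin.suc i) t t≈0 =
    trans (+-cong (t≈0 Fin.zero (λ ())) (sum-single i (t ∘ Fin.suc) (λ j j≢i → t≈0 (Fin.suc j) (j≢i ∘ Fin.suc-injective))))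
          (+-identityˡ _)

  -- The enumeration is a bijection, so exactly one index hits zero. The element listed there is
  -- only equivalent to `F.0#`, whence `h-cong`.
  ∑-elements : (h : F.Carrier → Carrier) → (∀ {x y} → x F.≈ y → h x ≈ h y) →
               ∑ elements h ≈ h F.0# + ∑ elements (λ x → nonzero x * h x)
  ∑-elements h h-cong = begin
    ∑ elements h                                              ≈⟨ ∑-cong elements split ⟩
    ∑ elements (λ x → atZero x + nonzero x * h x)              ≈⟨ ∑-distrib-+ elements _ _ ⟩
    ∑ elements atZero + ∑ elements (λ x → nonzero x * h x)     ≈⟨ +-congʳ sum-atZero ⟩
    h F.0# + ∑ elements (λ x → nonzero x * h x)                ∎
    where
    atZero : F.Carrier → Carrier
    atZero x with x ≟ F.0#
    ... | yes _ = h F.0#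
    ... | no  _ = 0#

    split : ∀ x → h x ≈ atZero x + nonzero x * h x
    split x with x ≟ F.0#
    ... | yes x≈0 = trans (h-cong x≈0) (sym (trans (+-congˡ (zeroˡ _)) (+-identityʳ _)))
    ... | no  _   = sym (trans (+-identityˡ _) (*-identityˡ _))

    atZero-≉0 : ∀ x → ¬ (x F.≈ F.0#) → atZero x ≈ 0#
    atZero-≉0 x x≉0 with x ≟ F.0#
    ... | yes x≈0 = contradiction x≈0 x≉0
    ... | no  _   = refl

    atZero-≈0 : ∀ x → x F.≈ F.0# → atZero x ≈ h F.0#
    atZero-≈0 x x≈0 with x ≟ F.0#
    ... | yes _   = refl
    ... | no  x≉0 = contradiction x≈0 x≉0

    sum-atZero : ∑ elements atZero ≈ h F.0#
    sum-atZero = begin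
      ∑ elements atZero           ≈⟨ ∑-tabulate to atZero ⟩
      sum (atZero ∘ to)           ≈⟨ sum-single (from F.0#) (atZero ∘ to)
                                       (λ i i≢ → atZero-≉0 (to i) (λ i≈0 →
                                         i≢ (≡.trans (≡.sym (strictlyInverseʳ i)) (from-cong i≈0)))) ⟩
      atZero (to (from F.0#))     ≈⟨ atZero-≈0 _ (strictlyInverseˡ F.0#) ⟩
      h F.0#                      ∎

-- Sums of multiplicative functions over F^×, in characteristic `suc p`.

module CharacterSum {c ℓ} (F : Field c ℓ) {q} (F-order : HasOrder F q)
  (p : ℕ) (p·1≈0 : Field._≈_ F (FieldProperties.ι F (suc p)) (Field.0# F)) where
  open Field F
  open FieldProperties F
  open FiniteField F F-order
  open Nonzero F F-order F
  open Polynomials.Enumeration F F-order using (elements)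
  open FiniteFieldSums F F-order F
  open FieldSums F
  open Inverse F-order using (to; from; strictlyInverseˡ)
  open SetoidReasoning setoid

  -- There are q - 1 nonzero elements and q · 1 = 0, so the count is -1, which `ι p` represents
  -- since `suc p` is zero in F.
  ∑-nonzero : ∑ elements nonzero ≈ ι p
  ∑-nonzero = +-cancelˡ 1# _ _ (begin
    1# + ∑ elements nonzero                   ≈⟨ +-congˡ (∑-cong elements (λ x → *-identityʳ _)) ⟨
    1# + ∑ elements (λ x → nonzero x * 1#)    ≈⟨ ∑-elements (λ _ → 1#) (λ _ → refl) ⟨
    ∑ elements (λ _ → 1#)                     ≈⟨ ∑-const elements 1# ⟩
    ι (List.length elements)                  ≈⟨ reflexive (≡.cong ι (List.length-tabulate to)) ⟩
    ι q                                       ≈⟨ order·1≈0 ⟩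
    0#                                        ≈⟨ p·1≈0 ⟨
    1# + ι p                                  ∎)

  module _ (t : Carrier → Carrier) (t-cong : ∀ {x y} → x ≈ y → t x ≈ t y)
           (t-* : ∀ x y → ¬ (x ≈ 0#) → t (x * y) ≈ t x * t y) where

    private
      T = ∑ elements (λ x → nonzero x * t x)

    -- Replacing x by y x gives T ≈ t y T for every y ≉ 0.
    characterSum : ∃ λ n → T ≈ ι n
    characterSum with Fin.any? (λ i → ¬? (to i ≟ 0#) ×-dec ¬? (t (to i) ≟ 1#))
    ... | yes (i , y≉0 , ty≉1) = 0 , *-cancelˡ-zero (λ eq → ty≉1 (x-y≈0⇒x≈y _ _ eq)) (begin
      (t y - 1#) * T      ≈⟨ [y-z]x≈yx-zx T (t y) 1# ⟩
      t y * T - 1# * T    ≈⟨ x≈y⇒x-y≈0 (trans invariant (sym (*-identityˡ T))) ⟩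
      0#                  ∎)
      where
      y = to i

      nonzero-* : ∀ x → nonzero (y * x) ≈ nonzero x
      nonzero-* x = nonzero-⇔ (*-cancelˡ-zero y≉0) (λ x≈0 → trans (*-congˡ x≈0) (zeroʳ y))

      invariant : t y * T ≈ T
      invariant = begin
        t y * T                                          ≈⟨ *-distribˡ-∑ (t y) elements _ ⟩
        ∑ elements (λ x → t y * (nonzero x * t x))       ≈⟨ ∑-cong elements (λ x → x*yz≈y*xz _ _ _) ⟩
        ∑ elements (λ x → nonzero x * (t y * t x))       ≈⟨ ∑-cong elements (λ x → *-cong (nonzero-* x) (t-* y x y≉0)) ⟨
        ∑ elements (λ x → nonzero (y * x) * t (y * x))   ≈⟨ ∑-permute (scaling y y≉0) _ (λ eq → *-cong (nonzero-cong eq) (t-cong eq)) ⟩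
        T                                                ∎
    -- No unit has a value other than 1, so T counts F^×; the witness `p` stands for -1.
    ... | no  ∄y = p , (begin
      T                     ≈⟨ ∑-cong elements (λ x → trans (nonzero-*-cong x (t≈1 x)) (*-identityʳ _)) ⟩
      ∑ elements nonzero    ≈⟨ ∑-nonzero ⟩
      ι p                   ∎)
      where
      t≈1 : ∀ x → ¬ (x ≈ 0#) → t x ≈ 1#
      t≈1 x x≉0 = decidable-stable (t x ≟ 1#) λ tx≉1 →
        ∄y (from x , (λ eq → x≉0 (trans (sym (strictlyInverseˡ x)) eq))
                   , (λ eq → tx≉1 (trans (t-cong (sym (strictlyInverseˡ x))) eq)))

  -- The sum of λ^(k-l) over λ ≉ 0.
  powerSum : ∀ k l → ∃ λ n → ∑ elements (λ x → nonzero x * (x ^ k * inv₀ x ^ l)) ≈ ι n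
  powerSum k l = characterSum (λ x → x ^ k * inv₀ x ^ l)
    (λ eq → *-cong (^-congˡ k eq) (^-congˡ l (inv₀-cong eq)))
    (λ x y x≉0 → trans (*-cong (^-distrib-* x y k) (trans (^-congˡ l (inv₀-* x≉0)) (^-distrib-* _ _ l)))
                       (*-interchange _ _ _ _))

-- Polynomials up to trailing zeros.

module PolynomialProperties {c ℓ} (F : Field c ℓ) where
  open Field F
  open Polynomials F

  infixl 6 _-ᴾ_
  _-ᴾ_ : Poly → Poly → Poly
  f -ᴾ g = f +ᴾ map (-_) g

  infixr 7 _*ᴾ_
  _*ᴾ_ : Carrier → Poly → Poly
  x *ᴾ f = map (x *_) f

  ∷-cong : ∀ {x y f g} → x ≈ y → f ≈ᴾ g → (x ∷ f) ≈ᴾ (y ∷ g)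
  ∷-cong x≈y f≈g zero    = x≈y
  ∷-cong x≈y f≈g (suc n) = f≈g n

  ≈ᴾ-refl : ∀ f → f ≈ᴾ f
  ≈ᴾ-refl f n = refl

  0∷[]≈[] : (0# ∷ []) ≈ᴾ []
  0∷[]≈[] zero    = refl
  0∷[]≈[] (suc n) = refl

  module _ (_≟_ : ∀ x y → Dec (x ≈ y)) where
    zero? : ∀ f → Dec (f ≈ᴾ [])
    zero? []      = yes (≈ᴾ-refl [])
    zero? (x ∷ f) with x ≟ 0# | zero? f
    ... | no  x≉0 | _       = no (λ eq → x≉0 (eq 0))
    ... | yes _   | no  f≉0 = no (λ eq → f≉0 (eq ∘ suc))
    ... | yes x≈0 | yes f≈0 = yes λ { zero → x≈0 ; (suc n) → f≈0 n }

-- Sums over polynomials of bounded degree.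

module PolynomialSums {c ℓ c′ ℓ′} (F : Field c ℓ) {q} (F-order : HasOrder F q) (K : Field c′ ℓ′) where
  private module F = Field F
  open FiniteField F F-order using (translation; negation; scaling)
  open Polynomials F
  open PolynomialProperties F
  open Enumeration F-order
  open Field K
  open FieldSums K
  open FiniteFieldSums F F-order K
  open Nonzero F F-order K
  open SetoidReasoning setoid

  Congruent : (Poly → Carrier) → Set _
  Congruent h = ∀ {f g} → f ≈ᴾ g → h f ≈ h g

  ∑-vectors-suc : ∀ d (h : Vec F.Carrier (suc d) → Carrier) →
                  ∑ (vectors (suc d)) h ≈ ∑ elements (λ x → ∑ (vectors d) (λ v → h (x ∷ v)))
  ∑-vectors-suc d = ∑-cartesianProductWith _∷_ elements (vectors d)

  -- The substitution is made one coefficient at a time, y ↦ x - y being a bijection of F. The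
  -- leading coefficients cancel to 1 - 1, so the difference is a list longer by one zero entry than
  -- the vector it is compared with; congruence of `h` absorbs that entry.
  ∑-monic-difference : ∀ d (v : Vec F.Carrier d) (h : Poly → Carrier) → Congruent h →
    ∑ (vectors d) (λ w → h (poly (d , v) -ᴾ poly (d , w))) ≈ ∑ (vectors d) (h ∘ Vec.toList)
  ∑-monic-difference zero    []      h h-cong = +-congʳ (h-cong λ { zero → F.-‿inverseʳ F.1# ; (suc n) → F.refl })
  ∑-monic-difference (suc d) (x ∷ v) h h-cong = begin
    _ ≈⟨ ∑-vectors-suc d _ ⟩
    ∑ elements (λ y → ∑ (vectors d) (λ w → h (x F.- y ∷ poly (d , v) -ᴾ poly (d , w))))
      ≈⟨ ∑-cong elements (λ y → ∑-monic-difference d v (h ∘ (x F.- y ∷_)) (h-cong ∘ ∷-cong F.refl)) ⟩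
    ∑ elements (λ y → ∑ (vectors d) (λ w → h (x F.- y ∷ Vec.toList w)))
      ≈⟨ ∑-permute (Composition.inverse negation (translation x)) (λ y → ∑ (vectors d) (λ w → h (y ∷ Vec.toList w)))
           (λ y≈y′ → ∑-cong (vectors d) (λ w → h-cong (∷-cong y≈y′ (≈ᴾ-refl (Vec.toList w))))) ⟩
    ∑ elements (λ y → ∑ (vectors d) (λ w → h (y ∷ Vec.toList w)))
      ≈⟨ ∑-vectors-suc d _ ⟨
    ∑ (vectors (suc d)) (h ∘ Vec.toList) ∎

  -- Serves the terms in which b is kept and a varies; the coefficientwise substitution is then a
  -- translation.
  ∑-monic-differenceʳ : ∀ d (w : Vec F.Carrier d) (h : Poly → Carrier) → Congruent h →
    ∑ (vectors d) (λ v → h (poly (d , v) -ᴾ poly (d , w))) ≈ ∑ (vectors d) (h ∘ Vec.toList)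
  ∑-monic-differenceʳ zero    []      h h-cong = +-congʳ (h-cong λ { zero → F.-‿inverseʳ F.1# ; (suc n) → F.refl })
  ∑-monic-differenceʳ (suc d) (y ∷ w) h h-cong = begin
    _ ≈⟨ ∑-vectors-suc d _ ⟩
    ∑ elements (λ x → ∑ (vectors d) (λ v → h (x F.- y ∷ poly (d , v) -ᴾ poly (d , w))))
      ≈⟨ ∑-cong elements (λ x → ∑-monic-differenceʳ d w (h ∘ (x F.- y ∷_)) (h-cong ∘ ∷-cong F.refl)) ⟩
    ∑ elements (λ x → ∑ (vectors d) (λ v → h (x F.- y ∷ Vec.toList v)))
      ≈⟨ ∑-cong elements (λ x → ∑-cong (vectors d) (λ v → h-cong (∷-cong (F.+-comm x _) (≈ᴾ-refl (Vec.toList v))))) ⟩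
    ∑ elements (λ x → ∑ (vectors d) (λ v → h (F.- y F.+ x ∷ Vec.toList v)))
      ≈⟨ ∑-permute (translation (F.- y)) (λ x → ∑ (vectors d) (λ v → h (x ∷ Vec.toList v)))
           (λ x≈x′ → ∑-cong (vectors d) (λ v → h-cong (∷-cong x≈x′ (≈ᴾ-refl (Vec.toList v))))) ⟩
    ∑ elements (λ x → ∑ (vectors d) (λ v → h (x ∷ Vec.toList v)))
      ≈⟨ ∑-vectors-suc d _ ⟨
    ∑ (vectors (suc d)) (h ∘ Vec.toList) ∎

  -- The sum of `h` over the polynomials of exact degree e, parametrised by leading coefficient and
  -- monic part.
  ∑-degree : ℕ → (Poly → Carrier) → Carrier
  ∑-degree e h = ∑ (vectors e) (λ v → ∑ elements (λ x → nonzero x * h (x *ᴾ poly (e , v))))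

  -- A new constant term y is free on the left, but on the right it is scaled by the leading
  -- coefficient x along with the rest. For x ≉ 0 the map y ↦ x y permutes F, so both range over the
  -- same values.
  ∑-degree-suc : ∀ e h → Congruent h → ∑ elements (λ y → ∑-degree e (h ∘ (y ∷_))) ≈ ∑-degree (suc e) h
  ∑-degree-suc e h h-cong = begin
    ∑ elements (λ y → ∑-degree e (h ∘ (y ∷_)))
      ≈⟨ ∑-comm elements (vectors e) _ ⟩
    ∑ (vectors e) (λ v → ∑ elements (λ y → ∑ elements (λ x → nonzero x * h (y ∷ x *ᴾ poly (e , v)))))
      ≈⟨ ∑-cong (vectors e) (λ v → ∑-comm elements elements _) ⟩
    ∑ (vectors e) (λ v → ∑ elements (λ x → ∑ elements (λ y → nonzero x * h (y ∷ x *ᴾ poly (e , v)))))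
      ≈⟨ ∑-cong (vectors e) (λ v → ∑-cong elements (λ x → rescale v x)) ⟩
    ∑ (vectors e) (λ v → ∑ elements (λ x → ∑ elements (λ y → nonzero x * h (x F.* y ∷ x *ᴾ poly (e , v)))))
      ≈⟨ ∑-cong (vectors e) (λ v → ∑-comm elements elements _) ⟨
    ∑ (vectors e) (λ v → ∑ elements (λ y → ∑ elements (λ x → nonzero x * h (x F.* y ∷ x *ᴾ poly (e , v)))))
      ≈⟨ ∑-comm elements (vectors e) _ ⟨
    ∑ elements (λ y → ∑ (vectors e) (λ v → ∑ elements (λ x → nonzero x * h (x F.* y ∷ x *ᴾ poly (e , v)))))
      ≈⟨ ∑-vectors-suc e _ ⟨
    ∑-degree (suc e) h ∎
    where
    rescale : ∀ v x → ∑ elements (λ y → nonzero x * h (y ∷ x *ᴾ poly (e , v))) ≈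
                      ∑ elements (λ y → nonzero x * h (x F.* y ∷ x *ᴾ poly (e , v)))
    rescale v x = begin
      ∑ elements (λ y → nonzero x * h (y ∷ x *ᴾ poly (e , v)))         ≈⟨ *-distribˡ-∑ _ elements _ ⟨
      nonzero x * ∑ elements (λ y → h (y ∷ x *ᴾ poly (e , v)))         ≈⟨ nonzero-*-cong x (λ x≉0 → ∑-permute (scaling x x≉0)
                                                                            (λ y → h (y ∷ x *ᴾ poly (e , v)))
                                                                            (λ eq → h-cong (∷-cong eq (≈ᴾ-refl (x *ᴾ poly (e , v)))))) ⟨
      nonzero x * ∑ elements (λ y → h (x F.* y ∷ x *ᴾ poly (e , v)))   ≈⟨ *-distribˡ-∑ _ elements _ ⟩
      ∑ elements (λ y → nonzero x * h (x F.* y ∷ x *ᴾ poly (e , v)))   ∎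

  -- A nonzero polynomial of degree < d is uniquely x times a monic one of degree e < d.
  ∑-vectors : ∀ d h → Congruent h →
              ∑ (vectors d) (h ∘ Vec.toList) ≈ h [] + ∑ (upTo d) (λ e → ∑-degree e h)
  ∑-vectors zero    h h-cong = refl
  ∑-vectors (suc d) h h-cong = begin
    ∑ (vectors (suc d)) (h ∘ Vec.toList)
      ≈⟨ ∑-vectors-suc d _ ⟩
    ∑ elements (λ y → ∑ (vectors d) (λ v → h (y ∷ Vec.toList v)))
      ≈⟨ ∑-cong elements (λ y → ∑-vectors d (h ∘ (y ∷_)) (h-cong ∘ ∷-cong F.refl)) ⟩
    ∑ elements (λ y → h (y ∷ []) + ∑ (upTo d) (λ e → ∑-degree e (h ∘ (y ∷_))))
      ≈⟨ ∑-distrib-+ elements _ _ ⟩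
    ∑ elements (λ y → h (y ∷ [])) + ∑ elements (λ y → ∑ (upTo d) (λ e → ∑-degree e (h ∘ (y ∷_))))
      ≈⟨ +-cong constants higher ⟩
    h [] + ∑-degree 0 h + ∑ (upTo d) (λ e → ∑-degree (suc e) h)
      ≈⟨ +-assoc _ _ _ ⟩
    h [] + (∑-degree 0 h + ∑ (upTo d) (λ e → ∑-degree (suc e) h))
      ≈⟨ +-congˡ (+-congˡ (∑-applyUpTo suc d _)) ⟨
    h [] + ∑ (upTo (suc d)) (λ e → ∑-degree e h) ∎
    where
    -- When all higher coefficients vanish, y = 0 gives the zero polynomial and y ≉ 0 a polynomial
    -- of degree 0.
    constants : ∑ elements (λ y → h (y ∷ [])) ≈ h [] + ∑-degree 0 h
    constants = begin
      ∑ elements (λ y → h (y ∷ []))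
        ≈⟨ ∑-elements (λ y → h (y ∷ [])) (λ eq → h-cong (∷-cong eq (≈ᴾ-refl []))) ⟩
      h (F.0# ∷ []) + ∑ elements (λ x → nonzero x * h (x ∷ []))
        ≈⟨ +-cong (h-cong 0∷[]≈[]) (∑-cong elements (λ x → *-congˡ (h-cong (∷-cong (F.sym (F.*-identityʳ x)) (≈ᴾ-refl []))))) ⟩
      h [] + ∑ elements (λ x → nonzero x * h (x F.* F.1# ∷ []))
        ≈⟨ +-congˡ (+-identityʳ _) ⟨
      h [] + ∑-degree 0 h ∎

    higher : ∑ elements (λ y → ∑ (upTo d) (λ e → ∑-degree e (h ∘ (y ∷_)))) ≈ ∑ (upTo d) (λ e → ∑-degree (suc e) h)
    higher = trans (∑-comm elements (upTo d) _) (∑-cong (upTo d) (λ e → ∑-degree-suc e h h-cong))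

-- Binary forms with natural coefficients, monomials and partial fractions.

module Forms {c ℓ} (K : Field c ℓ) where
  open Field K hiding (zero)
  open FieldProperties K
  open FieldSums K
  open SetoidReasoning setoid
  open SemiringSolver commutativeSemiring using (solve; _:+_; _:*_; _:=_; con)

  -- A homogeneous polynomial function of degree N in w and u. The coefficients are chosen before w
  -- and u, which is what later makes them independent of d.
  Form : ℕ → (Carrier → Carrier → Carrier) → Set _
  Form N f = ∃ λ (a : ℕ → ℕ → ℕ) →
    ∀ w u → f w u ≈ ∑ (splittings N) (λ (k , l) → ι (a k l) * (w ^ k * u ^ l))

  form-1 : Form 0 (λ _ _ → 1#)
  form-1 = (λ _ _ → 1) , λ w u → sym (trans (+-identityʳ _) (trans (*-cong ι-1 (*-identityˡ 1#)) (*-identityˡ 1#)))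

  form-resp : ∀ {N f g} → Form N f → (∀ w u → g w u ≈ f w u) → Form N g
  form-resp (a , eq) g≈f = a , λ w u → trans (g≈f w u) (eq w u)

  form-ι* : ∀ {N f} → Form N f → ∀ n → Form N (λ w u → ι n * f w u)
  form-ι* {N} {f} (a , eq) n = (λ k l → n ℕ.* a k l) , λ w u → begin
    ι n * f w u                                                       ≈⟨ *-congˡ (eq w u) ⟩
    ι n * ∑ (splittings N) (λ (k , l) → ι (a k l) * (w ^ k * u ^ l))   ≈⟨ *-distribˡ-∑ (ι n) (splittings N) _ ⟩
    ∑ (splittings N) (λ (k , l) → ι n * (ι (a k l) * (w ^ k * u ^ l))) ≈⟨ ∑-cong (splittings N) (λ (k , l) →
      trans (*-congʳ (×1-homo-* n (a k l))) (*-assoc _ _ _)) ⟨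
    ∑ (splittings N) (λ (k , l) → ι (n ℕ.* a k l) * (w ^ k * u ^ l))   ∎

  form-w* : ∀ {N f} → Form N f → Form (suc N) (λ w u → w * f w u)
  form-w* {N} {f} (a , eq) = a′ , λ w u → begin
    w * f w u                                                          ≈⟨ *-congˡ (eq w u) ⟩
    w * ∑ (splittings N) (λ (k , l) → ι (a k l) * (w ^ k * u ^ l))      ≈⟨ *-distribˡ-∑ w (splittings N) _ ⟩
    ∑ (splittings N) (λ (k , l) → w * (ι (a k l) * (w ^ k * u ^ l)))    ≈⟨ ∑-cong (splittings N) (λ (k , l) →
      solve 4 (λ w a x y → w :* (a :* (x :* y)) := a :* (w :* x :* y)) refl w _ _ _) ⟩
    ∑ (splittings N) (λ (k , l) → ι (a k l) * (w ^ suc k * u ^ l))      ≈⟨ +-identityˡ _ ⟨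
    0# + ∑ (splittings N) (λ (k , l) → ι (a k l) * (w ^ suc k * u ^ l)) ≈⟨ +-congʳ (zeroˡ _) ⟨
    _                                                                  ≈⟨ ∑-splittings-suc N _ ⟨
    ∑ (splittings (suc N)) (λ (k , l) → ι (a′ k l) * (w ^ k * u ^ l))   ∎
    where
    a′ : ℕ → ℕ → ℕ
    a′ zero    l = 0
    a′ (suc k) l = a k l

  form-u* : ∀ {N f} → Form N f → Form (suc N) (λ w u → u * f w u)
  form-u* {N} {f} (a , eq) = a′ , λ w u → begin
    u * f w u                                                          ≈⟨ *-congˡ (eq w u) ⟩
    u * ∑ (splittings N) (λ (k , l) → ι (a k l) * (w ^ k * u ^ l))      ≈⟨ *-distribˡ-∑ u (splittings N) _ ⟩
    ∑ (splittings N) (λ (k , l) → u * (ι (a k l) * (w ^ k * u ^ l)))    ≈⟨ ∑-cong (splittings N) (λ (k , l) →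
      solve 4 (λ u a x y → u :* (a :* (x :* y)) := a :* (x :* (u :* y))) refl u _ _ _) ⟩
    ∑ (splittings N) (λ (k , l) → ι (a k l) * (w ^ k * u ^ suc l))      ≈⟨ +-identityʳ _ ⟨
    ∑ (splittings N) (λ (k , l) → ι (a k l) * (w ^ k * u ^ suc l)) + 0# ≈⟨ +-congˡ (zeroˡ _) ⟨
    _                                                                  ≈⟨ ∑-splittings-sucʳ N _ ⟨
    ∑ (splittings (suc N)) (λ (k , l) → ι (a′ k l) * (w ^ k * u ^ l))   ∎
    where
    a′ : ℕ → ℕ → ℕ
    a′ k zero    = 0
    a′ k (suc l) = a k l

  form-+ : ∀ {N f g} → Form N f → Form N g → Form N (λ w u → f w u + g w u)
  form-+ {N} {f} {g} (a , eq) (b , eq′) = (λ k l → a k l ℕ.+ b k l) , λ w u → begin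
    f w u + g w u                                                   ≈⟨ +-cong (eq w u) (eq′ w u) ⟩
    _                                                               ≈⟨ ∑-distrib-+ (splittings N) _ _ ⟨
    ∑ (splittings N) (λ (k , l) → ι (a k l) * (w ^ k * u ^ l) + ι (b k l) * (w ^ k * u ^ l))
      ≈⟨ ∑-cong (splittings N) (λ (k , l) → trans (*-congʳ (ι-+ (a k l) (b k l))) (distribʳ _ _ _)) ⟨
    ∑ (splittings N) (λ (k , l) → ι (a k l ℕ.+ b k l) * (w ^ k * u ^ l)) ∎

  form-linear* : ∀ n {N f} → Form N f → Form (suc N) (λ w u → (w + ι n * u) * f w u)
  form-linear* n F = form-resp (form-+ (form-w* F) (form-ι* (form-u* F) n))
    (λ w u → trans (distribʳ _ _ _) (+-congˡ (*-assoc _ _ _)))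

  form-w^ : ∀ N → Form N (λ w u → w ^ N)
  form-w^ zero    = form-1
  form-w^ (suc N) = form-w* (form-w^ N)

  form-linear^ : ∀ n₁ n₂ s t → Form (s ℕ.+ t) (λ w u → (w + ι n₁ * u) ^ s * (w + ι n₂ * u) ^ t)
  form-linear^ n₁ n₂ zero    zero    = form-resp form-1 (λ w u → *-identityˡ 1#)
  form-linear^ n₁ n₂ zero    (suc t) = form-resp (form-linear* n₂ (form-linear^ n₁ n₂ zero t)) (λ w u → x*yz≈y*xz _ _ _)
  form-linear^ n₁ n₂ (suc s) t       = form-resp (form-linear* n₁ (form-linear^ n₁ n₂ s t)) (λ w u → *-assoc _ _ _)

  -- `eval α a` is this monomial at the point with coordinates `⟦ δ i ⟧ a`.
  monomial : ∀ {s} → SemiChar s → (Fin s → Carrier) → Carrier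
  monomial α x = ∏ (λ i → x i ^ Vec.lookup α i)

  -- At each index two powers of linear forms multiply to a form whose degree is the sum of the two
  -- exponents. Its splittings, combined over all indices, are exactly the factorizations of
  -- `σ ⊗ ψ`.
  monomial-expansion : ∀ n₁ n₂ {s} (σ ψ : SemiChar s) → ∃ λ (a : SemiChar s → SemiChar s → ℕ) →
    ∀ (w u x y : Fin s → Carrier) → (∀ i → x i ≈ w i + ι n₁ * u i) → (∀ i → y i ≈ w i + ι n₂ * u i) →
    monomial σ x * monomial ψ y ≈
    ∑ (factorizations (σ ⊗ ψ)) (λ (α , β) → ι (a α β) * (monomial α w * monomial β u))
  monomial-expansion n₁ n₂ [] [] = (λ _ _ → 1) , λ w u x y _ _ →
    sym (trans (+-identityʳ _) (trans (*-congʳ ι-1) (*-identityˡ _)))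
  monomial-expansion n₁ n₂ (m ∷ σ) (n ∷ ψ)
    with form-linear^ n₁ n₂ m n | monomial-expansion n₁ n₂ σ ψ
  ... | a , eq | b , eq′ = (λ { (k ∷ α) (l ∷ β) → a k l ℕ.* b α β }) , λ w u x y x≈ y≈ → begin
    (x 0F ^ m * monomial σ (x ∘ Fin.suc)) * (y 0F ^ n * monomial ψ (y ∘ Fin.suc))
      ≈⟨ *-interchange _ _ _ _ ⟩
    (x 0F ^ m * y 0F ^ n) * (monomial σ (x ∘ Fin.suc) * monomial ψ (y ∘ Fin.suc))
      ≈⟨ *-cong (trans (*-cong (^-congˡ m (x≈ 0F)) (^-congˡ n (y≈ 0F))) (eq (w 0F) (u 0F)))
                (eq′ (w ∘ Fin.suc) (u ∘ Fin.suc) (x ∘ Fin.suc) (y ∘ Fin.suc) (x≈ ∘ Fin.suc) (y≈ ∘ Fin.suc)) ⟩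
    _ ≈⟨ ∑-*-∑ (splittings (m ℕ.+ n)) (factorizations (σ ⊗ ψ)) _ _ ⟩
    _ ≈⟨ ∑-cong (splittings (m ℕ.+ n)) (λ (k , l) → ∑-cong (factorizations (σ ⊗ ψ)) (λ (α , β) →
           trans (*-congʳ (×1-homo-* (a k l) (b α β)))
                 (solve 6 (λ a b c d e f → a :* b :* (c :* d :* (e :* f)) := a :* (c :* e) :* (b :* (d :* f)))
                   refl _ _ _ _ _ _))) ⟨
    _ ≈⟨ ∑-cartesianProductWith _ (splittings (m ℕ.+ n)) (factorizations (σ ⊗ ψ)) _ ⟨
    _ ∎
    where
    0F : ∀ {s} → Fin (suc s)
    0F = Fin.zero

  -- Used in characteristic p + 1, where ι p is -1.
  module PartialFractions (p : ℕ) where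

    -- Here x, y, u stand for the reciprocals of γ_a, γ_b, γ_{a-b}, related by x y = u (y - x).
    -- Splitting off `x * u` and `y * u` ensures that both exponents in each resulting term are at
    -- least 1.
    PartialFraction : ℕ → (Carrier → Carrier → Carrier → Carrier) → Set _
    PartialFraction N f = ∃₂ λ g h → Form N g × Form N h ×
      (∀ x y u → x * y ≈ u * (y + ι p * x) → f x y u ≈ (x * u) * g x u + (y * u) * h y u)

    -- Induction on m + n: the relation replaces one factor `x * y` by u y - u x, lowering the total
    -- exponent of x and y by one. A term in which x or y has disappeared is already of the required
    -- shape; the others fall under the smaller N.
    partialFraction : ∀ N m n → m ℕ.+ n ≡ N → PartialFraction N (λ x y u → x ^ suc m * y ^ suc n)
    partialFraction zero zero zero _ =
      _ , _ , form-ι* form-1 p , form-1 , λ x y u rel → begin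
        (x * 1#) * (y * 1#)                 ≈⟨ *-cong (*-identityʳ x) (*-identityʳ y) ⟩
        x * y                               ≈⟨ rel ⟩
        u * (y + ι p * x)                   ≈⟨ solve 4 (λ p x y u → u :* (y :+ p :* x) := (x :* u) :* (p :* con 1) :+ (y :* u) :* con 1) refl _ _ _ _ ⟩
        (x * u) * (ι p * 1#) + (y * u) * 1# ∎
    partialFraction (suc N) zero (suc N) ≡.refl with partialFraction N 0 N ≡.refl
    ... | g , h , Fg , Fh , eq =
      _ , _ , form-ι* (form-u* Fg) p , form-+ (form-w^ (suc N)) (form-ι* (form-u* Fh) p) , λ x y u rel → begin
        x * 1# * (y * y ^ suc N)
          ≈⟨ trans (*-congʳ (*-identityʳ x)) (sym (*-assoc _ _ _)) ⟩
        x * y * y ^ suc N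
          ≈⟨ *-congʳ rel ⟩
        u * (y + ι p * x) * y ^ suc N
          ≈⟨ solve 5 (λ p x y z u → u :* (y :+ p :* x) :* z := u :* y :* z :+ p :* u :* (x :* z)) refl _ _ _ _ _ ⟩
        u * y * y ^ suc N + ι p * u * (x * y ^ suc N)
          ≈⟨ +-congˡ (*-congˡ (trans (*-congʳ (sym (*-identityʳ x))) (eq x y u rel))) ⟩
        u * y * y ^ suc N + ι p * u * ((x * u) * g x u + (y * u) * h y u)
          ≈⟨ solve 7 (λ p x y z u g h → u :* y :* z :+ p :* u :* ((x :* u) :* g :+ (y :* u) :* h)
                                      := (x :* u) :* (p :* (u :* g)) :+ (y :* u) :* (z :+ p :* (u :* h))) refl _ _ _ _ _ _ _ ⟩
        (x * u) * (ι p * (u * g x u)) + (y * u) * (y ^ suc N + ι p * (u * h y u)) ∎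
    partialFraction (suc N) (suc m) zero m+0≡N
      with ≡.refl ← ≡.trans (≡.sym (ℕ.+-identityʳ m)) (ℕ.suc-injective m+0≡N)
      with partialFraction N N 0 (ℕ.+-identityʳ N)
    ... | g , h , Fg , Fh , eq =
      _ , _ , form-+ (form-u* Fg) (form-ι* (form-w^ (suc N)) p) , form-u* Fh , λ x y u rel → begin
        x * x ^ suc N * (y * 1#)
          ≈⟨ trans (*-congˡ (*-identityʳ y)) (solve 3 (λ x z y → x :* z :* y := x :* y :* z) refl _ _ _) ⟩
        x * y * x ^ suc N
          ≈⟨ *-congʳ rel ⟩
        u * (y + ι p * x) * x ^ suc N
          ≈⟨ solve 5 (λ p x y z u → u :* (y :+ p :* x) :* z := u :* (z :* y) :+ p :* u :* (x :* z)) refl _ _ _ _ _ ⟩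
        u * (x ^ suc N * y) + ι p * u * (x * x ^ suc N)
          ≈⟨ +-congʳ (*-congˡ (trans (*-congˡ (sym (*-identityʳ y))) (eq x y u rel))) ⟩
        u * ((x * u) * g x u + (y * u) * h y u) + ι p * u * (x * x ^ suc N)
          ≈⟨ solve 7 (λ p x y z u g h → u :* ((x :* u) :* g :+ (y :* u) :* h) :+ p :* u :* (x :* z)
                                      := (x :* u) :* (u :* g :+ p :* z) :+ (y :* u) :* (u :* h)) refl _ _ _ _ _ _ _ ⟩
        (x * u) * (u * g x u + ι p * x ^ suc N) + (y * u) * (u * h y u) ∎
    partialFraction (suc N) (suc m) (suc n) m+n≡N
      with partialFraction N m (suc n) (ℕ.suc-injective m+n≡N)
         | partialFraction N (suc m) n (≡.trans (≡.sym (ℕ.+-suc m n)) (ℕ.suc-injective m+n≡N))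
    ... | g₁ , h₁ , Fg₁ , Fh₁ , eq₁ | g₂ , h₂ , Fg₂ , Fh₂ , eq₂ =
      _ , _ , form-+ (form-u* Fg₁) (form-ι* (form-u* Fg₂) p) , form-+ (form-u* Fh₁) (form-ι* (form-u* Fh₂) p) , λ x y u rel → begin
        x * x ^ suc m * (y * y ^ suc n)
          ≈⟨ *-interchange _ _ _ _ ⟩
        x * y * (x ^ suc m * y ^ suc n)
          ≈⟨ *-congʳ rel ⟩
        u * (y + ι p * x) * (x ^ suc m * y ^ suc n)
          ≈⟨ solve 6 (λ p x y z v u → u :* (y :+ p :* x) :* (z :* v) := u :* (z :* (y :* v)) :+ p :* u :* (x :* z :* v)) refl _ _ _ _ _ _ ⟩
        u * (x ^ suc m * y ^ suc (suc n)) + ι p * u * (x ^ suc (suc m) * y ^ suc n)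
          ≈⟨ +-cong (*-congˡ (eq₁ x y u rel)) (*-congˡ (eq₂ x y u rel)) ⟩
        u * ((x * u) * g₁ x u + (y * u) * h₁ y u) + ι p * u * ((x * u) * g₂ x u + (y * u) * h₂ y u)
          ≈⟨ solve 8 (λ p x y u g₁ h₁ g₂ h₂ →
               u :* ((x :* u) :* g₁ :+ (y :* u) :* h₁) :+ p :* u :* ((x :* u) :* g₂ :+ (y :* u) :* h₂)
               := (x :* u) :* (u :* g₁ :+ p :* (u :* g₂)) :+ (y :* u) :* (u :* h₁ :+ p :* (u :* h₂))) refl _ _ _ _ _ _ _ _ ⟩
        (x * u) * (u * g₁ x u + ι p * (u * g₂ x u)) + (y * u) * (u * h₁ y u + ι p * (u * h₂ y u)) ∎

-- Monomials under products and scaling.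

module MonomialProperties {c ℓ} (K : Field c ℓ) where
  open Field K hiding (zero)
  open FieldProperties K
  open Forms K using (monomial)

  monomial-cong : ∀ {s} (α : SemiChar s) {x y : Fin s → Carrier} → (∀ i → x i ≈ y i) → monomial α x ≈ monomial α y
  monomial-cong []      x≈y = refl
  monomial-cong (k ∷ α) x≈y = *-cong (^-congˡ k (x≈y Fin.zero)) (monomial-cong α (x≈y ∘ Fin.suc))

  monomial-⊗ : ∀ {s} (α β : SemiChar s) x → monomial (α ⊗ β) x ≈ monomial α x * monomial β x
  monomial-⊗ []      []      x = sym (*-identityˡ 1#)
  monomial-⊗ (k ∷ α) (l ∷ β) x =
    trans (*-cong (^-homo-* (x Fin.zero) k l) (monomial-⊗ α β (x ∘ Fin.suc))) (*-interchange _ _ _ _)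

  monomial-scale : ∀ {s} (α : SemiChar s) k x → monomial α (λ i → k * x i) ≈ k ^ Vec.sum α * monomial α x
  monomial-scale []      k x = sym (*-identityˡ 1#)
  monomial-scale (n ∷ α) k x =
    trans (*-cong (^-distrib-* k (x Fin.zero) n) (monomial-scale α k (x ∘ Fin.suc)))
      (trans (*-interchange _ _ _ _) (*-congʳ (sym (^-homo-* k n (Vec.sum α)))))

-- Power sums in L and their product.

module Products
  {c ℓ c′ ℓ′} (F : Field c ℓ) {q} (F-order : HasOrder F q) (L : Field c′ ℓ′) (ext : FieldExtension F L)
  {s} (δ : Fin s → InjectiveLinearMap ext) (γ : InjectiveLinearMap ext)
  (p : ℕ) (p·1≈0 : Field._≈_ F (FieldProperties.ι F (suc p)) (Field.0# F))
  where

  private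
    module F where
      open Field F public
      open FieldProperties F public
      open FieldSums F public
      open Nonzero F F-order F public

  open Field L hiding (zero)
  open FieldProperties L
  open FieldSums L
  open Nonzero F F-order L
  open FiniteField F F-order using (_≟_; inv₀; inv₀-inverse)
  open Polynomials F
  open Enumeration F-order
  open PolynomialProperties F
  open PolynomialSums F F-order L
  open Forms L
  open MonomialProperties L
  open PowerSums F-order ext δ γ
  open InjectiveLinearMap
  open FieldExtension ext using (embed; isRingHomomorphism)
  open RingMorphisms.IsRingHomomorphism isRingHomomorphism
    using (+-homo; *-homo; 0#-homo; 1#-homo) renaming (⟦⟧-cong to embed-cong)
  open SetoidReasoning setoid
  open SemiringSolver commutativeSemiring using (solve; _:+_; _:*_; _:=_)

  embed-ι : ∀ n → embed (F.ι n) ≈ ι n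
  embed-ι zero    = 0#-homo
  embed-ι (suc n) = trans (+-homo _ _) (+-cong 1#-homo (embed-ι n))

  embed-^ : ∀ x n → embed (x F.^ n) ≈ embed x ^ n
  embed-^ x zero    = 1#-homo
  embed-^ x (suc n) = trans (*-homo _ _) (*-congˡ (embed-^ x n))

  embed-∑ : (xs : List A) (h : A → F.Carrier) → embed (F.∑ xs h) ≈ ∑ xs (embed ∘ h)
  embed-∑ []       h = 0#-homo
  embed-∑ (x ∷ xs) h = trans (+-homo _ _) (+-congˡ (embed-∑ xs h))

  embed-nonzero : ∀ x → embed (F.nonzero x) ≈ nonzero x
  embed-nonzero x with x ≟ F.0#
  ... | yes _ = 0#-homo
  ... | no  _ = 1#-homo

  -- The sum is evaluated in F, where equality is decidable, and only then carried to L, for which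
  -- no decidable equality is assumed.
  embed-powerSum : ∀ k l → ∃ λ n → ∑ elements (λ x → nonzero x * (embed x ^ k * embed (inv₀ x) ^ l)) ≈ ι n
  embed-powerSum k l with CharacterSum.powerSum F F-order p p·1≈0 k l
  ... | n , eq = n , (begin
    ∑ elements (λ x → nonzero x * (embed x ^ k * embed (inv₀ x) ^ l))
      ≈⟨ ∑-cong elements (λ x → trans (*-homo _ _) (*-cong (embed-nonzero x)
           (trans (*-homo _ _) (*-cong (embed-^ x k) (embed-^ (inv₀ x) l))))) ⟨
    ∑ elements (λ x → embed (F.nonzero x F.* (x F.^ k F.* inv₀ x F.^ l)))
      ≈⟨ embed-∑ elements _ ⟨
    embed (F.∑ elements (λ x → F.nonzero x F.* (x F.^ k F.* inv₀ x F.^ l)))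
      ≈⟨ embed-cong eq ⟩
    embed (F.ι n)
      ≈⟨ embed-ι n ⟩
    ι n ∎)

  ι-char : ι (suc p) ≈ 0#
  ι-char = trans (sym (embed-ι (suc p))) (trans (embed-cong p·1≈0) 0#-homo)

  ι-p* : ∀ x → ι p * x ≈ - x
  ι-p* x = trans (*-congʳ (+-inverseʳ-unique 1# (ι p) ι-char)) (trans (sym (-‿distribˡ-* 1# x)) (-‿cong (*-identityˡ x)))

  -- Multiples of the characteristic vanish in L, so a natural coefficient may be replaced by its
  -- residue, which is the element of 𝔽_p asked for.
  residue-mod : ∀ n → residue {suc p} (n ℕ.mod suc p) ≈ ι n
  residue-mod n = begin
    ι (toℕ (n ℕ.mod suc p))                                  ≈⟨ reflexive (≡.cong ι (Fin.toℕ-fromℕ< (ℕ.m%n<n n (suc p)))) ⟩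
    ι (n ℕ.% suc p)                                          ≈⟨ +-identityʳ _ ⟨
    ι (n ℕ.% suc p) + 0#                                     ≈⟨ +-congˡ (trans (×1-homo-* (n ℕ./ suc p) (suc p))
                                                                  (trans (*-congˡ ι-char) (zeroʳ _))) ⟨
    ι (n ℕ.% suc p) + ι (n ℕ./ suc p ℕ.* suc p)               ≈⟨ ι-+ (n ℕ.% suc p) _ ⟨
    ι (n ℕ.% suc p ℕ.+ n ℕ./ suc p ℕ.* suc p)                 ≈⟨ reflexive (≡.cong ι (ℕ.m≡m%n+[m/n]*n n (suc p))) ⟨
    ι n                                                      ∎

  ⟦⟧-difference : ∀ (φ : InjectiveLinearMap ext) f g → ⟦ φ ⟧ (f -ᴾ g) ≈ ⟦ φ ⟧ f - ⟦ φ ⟧ g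
  ⟦⟧-difference φ f g = trans (+ᴹ-homo φ f (map F.-_ g)) (+-congˡ (-ᴹ-homo φ g))

  eval-cong : ∀ α {f g} → f ≈ᴾ g → eval α f ≈ eval α g
  eval-cong α f≈g = monomial-cong α (λ i → ⟦⟧-cong (δ i) f≈g)

  eval-scale : ∀ α x f → eval α (x *ᴾ f) ≈ embed x ^ Vec.sum α * eval α f
  eval-scale α x f = trans (monomial-cong α (λ i → *ₗ-homo (δ i) x f)) (monomial-scale α (embed x) _)

  -- With recip 0 = 0 the off-diagonal terms vanish for a = b, so that they can be summed over all pairs.
  abstract
    recip : Poly → Carrier
    recip f with zero? _≟_ f
    ... | yes _   = 0#
    ... | no  f≉0 = inv (⟦ γ ⟧ f) (λ eq → f≉0 (injective γ (trans eq (sym (0ᴹ-homo γ)))))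

    recip-zero : ∀ {f} → f ≈ᴾ [] → recip f ≈ 0#
    recip-zero {f} f≈0 with zero? _≟_ f
    ... | yes _   = refl
    ... | no  f≉0 = contradiction f≈0 f≉0

    recip-inverse : ∀ {f} → ¬ (f ≈ᴾ []) → ⟦ γ ⟧ f * recip f ≈ 1#
    recip-inverse {f} f≉0 with zero? _≟_ f
    ... | yes f≈0 = contradiction f≈0 f≉0
    ... | no  f≉0 = proj₂ (inverse _ _)

  recip-unique : ∀ f {x} → ⟦ γ ⟧ f * x ≈ 1# → recip f ≈ x
  recip-unique f fx≈1 = *-inverse-unique (recip-inverse f≉0) fx≈1
    where
    f≉0 : ¬ (f ≈ᴾ [])
    f≉0 f≈0 = x*y≈1⇒x≉0 fx≈1 (trans (⟦⟧-cong γ f≈0) (0ᴹ-homo γ))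

  recip-monic : ∀ a → recip (poly a) ≈ ⟦ γ ⟧⁻¹ a
  recip-monic a = recip-unique (poly a) (proj₂ (inverse _ _))

  recip-cong : ∀ {f g} → f ≈ᴾ g → recip f ≈ recip g
  recip-cong {f} {g} f≈g with zero? _≟_ g
  ... | yes g≈0 = trans (recip-zero (λ n → F.trans (f≈g n) (g≈0 n))) (sym (recip-zero g≈0))
  ... | no  g≉0 = recip-unique f (trans (*-congʳ (⟦⟧-cong γ f≈g)) (recip-inverse g≉0))

  recip-scale : ∀ {x} f → ¬ (x F.≈ F.0#) → recip (x *ᴾ f) ≈ embed (inv₀ x) * recip f
  recip-scale {x} f x≉0 with zero? _≟_ f
  ... | yes f≈0 = trans (recip-zero (*ᴾ-zero f f≈0)) (sym (trans (*-congˡ (recip-zero f≈0)) (zeroʳ _)))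
    where
    *ᴾ-zero : ∀ f → f ≈ᴾ [] → (x *ᴾ f) ≈ᴾ []
    *ᴾ-zero []      f≈0 = f≈0
    *ᴾ-zero (y ∷ f) f≈0 zero    = F.trans (F.*-congˡ (f≈0 0)) (F.zeroʳ x)
    *ᴾ-zero (y ∷ f) f≈0 (suc n) = *ᴾ-zero f (f≈0 ∘ suc) n
  ... | no  f≉0 = recip-unique (x *ᴾ f) (begin
    ⟦ γ ⟧ (x *ᴾ f) * (embed (inv₀ x) * recip f)      ≈⟨ *-congʳ (*ₗ-homo γ x f) ⟩
    embed x * ⟦ γ ⟧ f * (embed (inv₀ x) * recip f)   ≈⟨ *-interchange _ _ _ _ ⟩
    embed x * embed (inv₀ x) * (⟦ γ ⟧ f * recip f)   ≈⟨ *-cong (trans (sym (*-homo _ _)) (trans (embed-cong (inv₀-inverse x≉0)) 1#-homo))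
                                                              (recip-inverse f≉0) ⟩
    1# * 1#                                          ≈⟨ *-identityˡ 1# ⟩
    1#                                               ∎)

  -- The summand α(f) / γ_f^i extended from monic polynomials to all polynomials; it vanishes at f =
  -- 0 as soon as i ≥ 1.
  quotient : SemiChar s → ℕ → Poly → Carrier
  quotient α i f = eval α f * recip f ^ i

  quotient-cong : ∀ α i → Congruent (quotient α i)
  quotient-cong α i f≈g = *-cong (eval-cong α f≈g) (^-congˡ i (recip-cong f≈g))

  quotient-monic : ∀ α i a → quotient α i (poly a) ≈ eval α (poly a) * ⟦ γ ⟧⁻¹ a ^ i
  quotient-monic α i a = *-congˡ (^-congˡ i (recip-monic a))

  -- Pulling the scalar out of α and of the reciprocal of γ^i gives its power |α| - i, kept as two
  -- factors because this difference may be negative.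
  quotient-scale : ∀ α i x f → nonzero x * quotient α i (x *ᴾ f) ≈
                   nonzero x * (embed x ^ Vec.sum α * embed (inv₀ x) ^ i) * quotient α i f
  quotient-scale α i x f = trans (nonzero-*-cong x (λ x≉0 → begin
    eval α (x *ᴾ f) * recip (x *ᴾ f) ^ i
      ≈⟨ *-cong (eval-scale α x f) (trans (^-congˡ i (recip-scale f x≉0)) (^-distrib-* _ _ i)) ⟩
    embed x ^ Vec.sum α * eval α f * (embed (inv₀ x) ^ i * recip f ^ i)
      ≈⟨ *-interchange _ _ _ _ ⟩
    embed x ^ Vec.sum α * embed (inv₀ x) ^ i * quotient α i f ∎)) (sym (*-assoc _ _ _))

  -- Power sums as sums over coefficient vectors.

  ∑-monics : ∀ d (h : Monic → Carrier) → ∑ (monics d) h ≈ ∑ (vectors d) (λ v → h (d , v))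
  ∑-monics d h = ∑-map {B = Monic} (λ v → d , v) (vectors d) h

  S-single : ∀ d σ m → S d (σ ∷ []) (m ∷ []) ≈ ∑ (vectors d) (λ v → quotient σ m (poly (d , v)))
  S-single d σ m = begin
    S d (σ ∷ []) (m ∷ [])   ≈⟨ ∑-map (_∷ []) (monics d) _ ⟩
    _                       ≈⟨ ∑-monics d _ ⟩
    _                       ≈⟨ ∑-cong (vectors d) (λ v → trans (quotient-monic σ m (d , v)) (sym (*-identityʳ _))) ⟨
    _                       ∎

  S-double : ∀ d α β i j → S d (α ∷ β ∷ []) (i ∷ j ∷ []) ≈
    ∑ (vectors d) (λ v → quotient α i (poly (d , v)) *
      ∑ (upTo d) (λ e → ∑ (vectors e) (λ w → quotient β j (poly (e , w)))))
  S-double d α β i j = begin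
    S d (α ∷ β ∷ []) (i ∷ j ∷ [])
      ≈⟨ ∑-cartesianProductWith _∷_ (monics d) (concatMap (chains 0) (upTo d)) _ ⟩
    _ ≈⟨ ∑-monics d _ ⟩
    ∑ (vectors d) (λ v → ∑ (concatMap (chains 0) (upTo d)) (λ b →
      eval α (poly (d , v)) * ⟦ γ ⟧⁻¹ (d , v) ^ i * summand (β ∷ []) (j ∷ []) b))
      ≈⟨ ∑-cong (vectors d) (λ v → *-distribˡ-∑ _ (concatMap (chains 0) (upTo d)) _) ⟨
    ∑ (vectors d) (λ v → eval α (poly (d , v)) * ⟦ γ ⟧⁻¹ (d , v) ^ i *
      ∑ (concatMap (chains 0) (upTo d)) (summand (β ∷ []) (j ∷ [])))
      ≈⟨ ∑-cong (vectors d) (λ v → *-cong (sym (quotient-monic α i (d , v)))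
           (trans (∑-concatMap (chains 0) (upTo d) _) (∑-cong (upTo d) (λ e → S-single e β j)))) ⟩
    _ ∎

  -- Represents the sum of λ^(|β| - j) over F^×, so it is 0 or `p`; it depends on β and j alone.
  exponentSum : SemiChar s → ℕ → ℕ
  exponentSum β j = proj₁ (embed-powerSum (Vec.sum β) j)

  -- The exponent `suc l` kills the term at the zero polynomial. In every degree the scalar factors
  -- out, leaving the same character sum each time.
  ∑-quotient : ∀ d β l → ∑ (vectors d) (quotient β (suc l) ∘ Vec.toList) ≈
    ι (exponentSum β (suc l)) * ∑ (upTo d) (λ e → ∑ (vectors e) (λ w → quotient β (suc l) (poly (e , w))))
  ∑-quotient d β l = begin
    ∑ (vectors d) (Q ∘ Vec.toList)                                 ≈⟨ ∑-vectors d Q (quotient-cong β (suc l)) ⟩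
    Q [] + ∑ (upTo d) (λ e → ∑-degree e Q)                         ≈⟨ +-congʳ Q[]≈0 ⟩
    0# + ∑ (upTo d) (λ e → ∑-degree e Q)                           ≈⟨ +-identityˡ _ ⟩
    ∑ (upTo d) (λ e → ∑-degree e Q)                                ≈⟨ ∑-cong (upTo d) degree ⟩
    ∑ (upTo d) (λ e → ι t * ∑ (vectors e) (λ w → Q (poly (e , w)))) ≈⟨ *-distribˡ-∑ _ (upTo d) _ ⟨
    _                                                              ∎
    where
    Q = quotient β (suc l)
    t = exponentSum β (suc l)

    Q[]≈0 : Q [] ≈ 0#
    Q[]≈0 = trans (*-congˡ (trans (^-congˡ (suc l) (recip-zero (≈ᴾ-refl []))) (0^1+n≈0 l))) (zeroʳ _)

    degree : ∀ e → ∑-degree e Q ≈ ι t * ∑ (vectors e) (λ w → Q (poly (e , w)))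
    degree e = begin
      ∑-degree e Q
        ≈⟨ ∑-cong (vectors e) (λ w → ∑-cong elements (λ x → quotient-scale β (suc l) x (poly (e , w)))) ⟩
      _ ≈⟨ ∑-cong (vectors e) (λ w → *-distribʳ-∑ _ elements _) ⟨
      _ ≈⟨ ∑-cong (vectors e) (λ w → *-congʳ (proj₂ (embed-powerSum (Vec.sum β) (suc l)))) ⟩
      ∑ (vectors e) (λ w → ι t * Q (poly (e , w)))
        ≈⟨ *-distribˡ-∑ _ (vectors e) _ ⟨
      _ ∎

  abstract
    -- Applied to a - b it marks the diagonal a = b.
    isZero : Poly → Carrier
    isZero f with zero? _≟_ f
    ... | yes _ = 1#
    ... | no  _ = 0#

    isZero-≈0 : ∀ {f} → f ≈ᴾ [] → isZero f ≈ 1#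
    isZero-≈0 {f} f≈0 with zero? _≟_ f
    ... | yes _   = refl
    ... | no  f≉0 = contradiction f≈0 f≉0

    isZero-≉0 : ∀ {f} → ¬ (f ≈ᴾ []) → isZero f ≈ 0#
    isZero-≉0 {f} f≉0 with zero? _≟_ f
    ... | yes f≈0 = contradiction f≈0 f≉0
    ... | no  _   = refl

  isZero-cong : Congruent isZero
  isZero-cong {f} {g} f≈g with zero? _≟_ g
  ... | yes g≈0 = trans (isZero-≈0 (λ n → F.trans (f≈g n) (g≈0 n))) (sym (isZero-≈0 g≈0))
  ... | no  g≉0 = trans (isZero-≉0 (λ f≈0 → g≉0 (λ n → F.trans (F.sym (f≈g n)) (f≈0 n)))) (sym (isZero-≉0 g≉0))

  -- Only the zero polynomial contributes: γ sends a nonzero multiple of a monic polynomial to a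
  -- product of two nonzero factors.
  ∑-isZero : ∀ d → ∑ (vectors d) (isZero ∘ Vec.toList) ≈ 1#
  ∑-isZero d = begin
    ∑ (vectors d) (isZero ∘ Vec.toList)                  ≈⟨ ∑-vectors d isZero isZero-cong ⟩
    isZero [] + ∑ (upTo d) (λ e → ∑-degree e isZero)     ≈⟨ +-cong (isZero-≈0 (≈ᴾ-refl []))
      (∑-zero (upTo d) λ e → ∑-zero (vectors e) λ v → ∑-zero elements λ x → trans (nonzero-*-cong x (λ x≉0 → isZero-≉0 (scaled≉0 x≉0 (e , v)))) (zeroʳ _)) ⟩
    1# + 0#                                              ≈⟨ +-identityʳ 1# ⟩
    1#                                                   ∎
    where
    scaled≉0 : ∀ {x} → ¬ (x F.≈ F.0#) → ∀ a → ¬ ((x *ᴾ poly a) ≈ᴾ [])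
    scaled≉0 {x} x≉0 a eq = ⟦monic⟧≉0 γ a (*-cancelˡ-zero
      (x*y≈1⇒x≉0 (trans (sym (*-homo _ _)) (trans (embed-cong (inv₀-inverse x≉0)) 1#-homo)))
      (trans (sym (*ₗ-homo γ x (poly a))) (trans (⟦⟧-cong γ eq) (0ᴹ-homo γ))))

  term : SemiChar s × SemiChar s → ℕ × ℕ → Poly → Poly → Carrier
  term (α , β) (k , l) f u = quotient α (suc k) f * quotient β (suc l) u

  -- Multiplies the expansion of the numerator by that of the denominator. The prefactor
  -- `recip f * recip u` raises both exponents by one, hence `suc k` and `suc l` in `term`.
  combine : ∀ τ N (a : SemiChar s → SemiChar s → ℕ) (b : ℕ → ℕ → ℕ) f u →
    ∀ {E G} → E ≈ ∑ (factorizations τ) (λ (α , β) → ι (a α β) * (eval α f * eval β u)) →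
              G ≈ ∑ (splittings N) (λ (k , l) → ι (b k l) * (recip f ^ k * recip u ^ l)) →
    E * (recip f * recip u * G) ≈
    ∑ (cartesianProduct (factorizations τ) (splittings N))
      (λ ((α , β) , (k , l)) → ι (a α β ℕ.* b k l) * term (α , β) (k , l) f u)
  combine τ N a b f u {E} {G} E≈ G≈ = begin
    E * (recip f * recip u * G)
      ≈⟨ *-cong E≈ (trans (*-congˡ G≈) (*-distribˡ-∑ _ (splittings N) _)) ⟩
    _ ≈⟨ ∑-*-∑ (factorizations τ) (splittings N) _ _ ⟩
    _ ≈⟨ ∑-cong (factorizations τ) (λ (α , β) → ∑-cong (splittings N) (λ (k , l) →
           trans (*-congʳ (×1-homo-* (a α β) (b k l)))
             (solve 8 (λ a b A B X U x u → a :* b :* (A :* (X :* x) :* (B :* (U :* u))) := a :* (A :* B) :* (X :* U :* (b :* (x :* u))))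
               refl _ _ _ _ _ _ _ _))) ⟨
    _ ≈⟨ ∑-cartesianProductWith _,_ (factorizations τ) (splittings N) _ ⟨
    _ ∎

  -- The product formula.

  module _ (σ ψ : SemiChar s) (m n : ℕ) where
    open PartialFractions p

    indices : List ((SemiChar s × SemiChar s) × (ℕ × ℕ))
    indices = cartesianProduct (factorizations (σ ⊗ ψ)) (splittings (m ℕ.+ n))

    Coefficients : Set
    Coefficients = (SemiChar s × SemiChar s) × (ℕ × ℕ) → ℕ

    -- One identity for all pairs: if u vanishes, so does every `term`, and if not, `isZero u` does.
    -- It can therefore be summed over all pairs without a case distinction.
    Expansion : Coefficients → Coefficients → Monic → Monic → Set _
    Expansion a b x y =
      let f = poly x ; g = poly y ; u = f -ᴾ g in
      quotient σ (suc m) f * quotient ψ (suc n) g ≈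
      isZero u * quotient (σ ⊗ ψ) (suc m ℕ.+ suc n) f +
      ∑ indices (λ (αβ , kl) → ι (a (αβ , kl)) * term αβ kl f u + ι (b (αβ , kl)) * term αβ kl g u)

    pointwiseExpansion : ∃₂ λ a b → ∀ x y → Expansion a b x y
    pointwiseExpansion
      -- The constants encode the two substitutions: 0 and `p` express both arguments through the
      -- first polynomial f, as f and f - u; 1 and 0 express them through the second one g, as g + u
      -- and g.
      with monomial-expansion 0 p σ ψ | monomial-expansion 1 0 σ ψ | partialFraction (m ℕ.+ n) m n ≡.refl
    ... | e₁ , expand₁ | e₂ , expand₂ | g₁ , g₂ , (b₁ , form₁) , (b₂ , form₂) , fraction =
      a , b , λ x y → case zero? _≟_ (poly x -ᴾ poly y) of λ
        { (yes u≈0) → diagonal x y u≈0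
        ; (no  u≉0) → offDiagonal x y u≉0
        }
      where
      a b : Coefficients
      a ((α , β) , (k , l)) = e₁ α β ℕ.* b₁ k l
      b ((α , β) , (k , l)) = e₂ α β ℕ.* b₂ k l

      module _ (x y : Monic) where
        private
          f = poly x
          g = poly y
          u = f -ᴾ g

        diagonal : u ≈ᴾ [] → Expansion a b x y
        diagonal u≈0 = begin
          quotient σ (suc m) f * quotient ψ (suc n) g
            ≈⟨ *-congˡ (quotient-cong ψ (suc n) f≈g) ⟨
          quotient σ (suc m) f * quotient ψ (suc n) f
            ≈⟨ *-interchange _ _ _ _ ⟩
          eval σ f * eval ψ f * (recip f ^ suc m * recip f ^ suc n)
            ≈⟨ *-cong (monomial-⊗ σ ψ _) (^-homo-* (recip f) (suc m) (suc n)) ⟨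
          quotient (σ ⊗ ψ) (suc m ℕ.+ suc n) f
            ≈⟨ trans (+-congʳ (trans (*-congʳ (isZero-≈0 u≈0)) (*-identityˡ _))) (+-identityʳ _) ⟨
          isZero u * quotient (σ ⊗ ψ) (suc m ℕ.+ suc n) f + 0#
            ≈⟨ +-congˡ (∑-zero indices (λ (αβ , kl) → trans (+-cong (vanish αβ kl) (vanish αβ kl)) (+-identityˡ 0#))) ⟨
          _ ∎
          where
          f≈g : f ≈ᴾ g
          f≈g = injective γ (x-y≈0⇒x≈y _ _ (trans (sym (⟦⟧-difference γ f g)) (trans (⟦⟧-cong γ u≈0) (0ᴹ-homo γ))))

          vanish : ∀ αβ kl {k h} → k * term αβ kl h u ≈ 0#
          vanish (α , β) (k , l) = trans (*-congˡ (trans (*-congˡ (trans (*-congˡ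
            (trans (^-congˡ (suc l) (recip-zero u≈0)) (0^1+n≈0 l))) (zeroʳ _))) (zeroʳ _))) (zeroʳ _)

        offDiagonal : ¬ (u ≈ᴾ []) → Expansion a b x y
        offDiagonal u≉0 = begin
          quotient σ (suc m) f * quotient ψ (suc n) g
            ≈⟨ *-interchange _ _ _ _ ⟩
          eval σ f * eval ψ g * (recip f ^ suc m * recip g ^ suc n)
            ≈⟨ *-congˡ (fraction (recip f) (recip g) (recip u) relation) ⟩
          eval σ f * eval ψ g * (recip f * recip u * g₁ (recip f) (recip u) + recip g * recip u * g₂ (recip g) (recip u))
            ≈⟨ distribˡ _ _ _ ⟩
          _ ≈⟨ +-cong
                 (combine (σ ⊗ ψ) (m ℕ.+ n) e₁ b₁ f u
                   (expand₁ _ _ _ _ (λ i → sym (trans (+-congˡ (zeroˡ _)) (+-identityʳ _)))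
                     (λ i → sym (trans (+-congˡ (trans (ι-p* _)
                       (trans (-‿cong (⟦⟧-difference (δ i) f g)) (-‿anti-homo‿- _ _)))) (x+[y-x]≈y _ _))))
                   (form₁ _ _))
                 (combine (σ ⊗ ψ) (m ℕ.+ n) e₂ b₂ g u
                   (expand₂ _ _ _ _
                     (λ i → sym (trans (+-congˡ (trans (*-congʳ ι-1)
                       (trans (*-identityˡ _) (⟦⟧-difference (δ i) f g)))) (x+[y-x]≈y _ _)))
                     (λ i → sym (trans (+-congˡ (zeroˡ _)) (+-identityʳ _))))
                   (form₂ _ _)) ⟩
          _ ≈⟨ ∑-distrib-+ indices _ _ ⟨
          _ ≈⟨ trans (+-congʳ (trans (*-congʳ (isZero-≉0 u≉0)) (zeroˡ _))) (+-identityˡ _) ⟨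
          _ ∎
          where
          x+[y-x]≈y : ∀ x y → x + (y - x) ≈ y
          x+[y-x]≈y x y = trans (+-comm x _) (trans (+-assoc y _ x) (trans (+-congˡ (-‿inverseˡ x)) (+-identityʳ y)))

          -- The linear relation γ_u = γ_f - γ_g, multiplied by all three reciprocals; u ≉ 0 makes
          -- the reciprocal of γ_u a true inverse.
          relation : recip f * recip g ≈ recip u * (recip g + ι p * recip f)
          relation = begin
            recip f * recip g
              ≈⟨ trans (*-congʳ (recip-inverse u≉0)) (*-identityˡ _) ⟨
            ⟦ γ ⟧ u * recip u * (recip f * recip g)
              ≈⟨ *-congʳ (*-congʳ (trans (⟦⟧-difference γ f g) (+-congˡ (sym (ι-p* _))))) ⟩
            (⟦ γ ⟧ f + ι p * ⟦ γ ⟧ g) * recip u * (recip f * recip g)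
              ≈⟨ solve 6 (λ x y p u X Y → (x :+ p :* y) :* u :* (X :* Y) := u :* (x :* X :* Y :+ p :* (y :* Y :* X))) refl _ _ _ _ _ _ ⟩
            recip u * (⟦ γ ⟧ f * recip f * recip g + ι p * (⟦ γ ⟧ g * recip g * recip f))
              ≈⟨ *-congˡ (+-cong (trans (*-congʳ (recip-inverse (monic≉0 x))) (*-identityˡ _))
                                 (*-congˡ (trans (*-congʳ (recip-inverse (monic≉0 y))) (*-identityˡ _)))) ⟩
            recip u * (recip g + ι p * recip f) ∎

    -- In the first kind of term a is fixed and b varies, in the second the reverse. In both cases
    -- the difference runs over all polynomials of degree < d, so the inner sums agree and the
    -- coefficients add up.
    ∑-term : ∀ d α β k l (a b : ℕ) →
      ∑ (vectors d) (λ v → ∑ (vectors d) (λ w →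
        ι a * term (α , β) (k , l) (poly (d , v)) (poly (d , v) -ᴾ poly (d , w)) +
        ι b * term (α , β) (k , l) (poly (d , w)) (poly (d , v) -ᴾ poly (d , w)))) ≈
      ι ((a ℕ.+ b) ℕ.* exponentSum β (suc l)) * S d (α ∷ β ∷ []) (suc k ∷ suc l ∷ [])
    ∑-term d α β k l a b = begin
      _ ≈⟨ ∑-cong V (λ v → ∑-distrib-+ V _ _) ⟩
      _ ≈⟨ ∑-distrib-+ V _ _ ⟩
      ∑ V (λ v → ∑ V (λ w → ι a * (P v * Q (poly (d , v) -ᴾ poly (d , w))))) +
      ∑ V (λ v → ∑ V (λ w → ι b * (P w * Q (poly (d , v) -ᴾ poly (d , w)))))
        ≈⟨ +-cong
             (∑-cong V (λ v → trans (factor a (P v))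
               (*-congˡ (*-congˡ (∑-monic-difference d v Q (quotient-cong β (suc l)))))))
             (trans (∑-comm V V _) (∑-cong V (λ w → trans (factor b (P w))
               (*-congˡ (*-congˡ (∑-monic-differenceʳ d w Q (quotient-cong β (suc l)))))))) ⟩
      ∑ V (λ v → ι a * (P v * T)) + ∑ V (λ v → ι b * (P v * T))
        ≈⟨ ∑-distrib-+ V _ _ ⟨
      ∑ V (λ v → ι a * (P v * T) + ι b * (P v * T))
        ≈⟨ ∑-cong V (λ v → collect (P v)) ⟩
      ∑ V (λ v → ι ((a ℕ.+ b) ℕ.* t) * (P v * R))
        ≈⟨ *-distribˡ-∑ _ V _ ⟨
      ι ((a ℕ.+ b) ℕ.* t) * ∑ V (λ v → P v * R)
        ≈⟨ *-congˡ (S-double d α β (suc k) (suc l)) ⟨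
      _ ∎
      where
      V = vectors d
      Q = quotient β (suc l)
      P = λ v → quotient α (suc k) (poly (d , v))
      T = ∑ V (Q ∘ Vec.toList)
      t = exponentSum β (suc l)
      R = ∑ (upTo d) (λ e → ∑ (vectors e) (λ w → Q (poly (e , w))))

      factor : ∀ a x {h} → ∑ V (λ w → ι a * (x * h w)) ≈ ι a * (x * ∑ V h)
      factor a x = sym (trans (*-congˡ (*-distribˡ-∑ x V _)) (*-distribˡ-∑ (ι a) V _))

      collect : ∀ x → ι a * (x * T) + ι b * (x * T) ≈ ι ((a ℕ.+ b) ℕ.* t) * (x * R)
      collect x = begin
        ι a * (x * T) + ι b * (x * T)              ≈⟨ distribʳ _ _ _ ⟨
        (ι a + ι b) * (x * T)                      ≈⟨ *-cong (sym (ι-+ a b)) (*-congˡ (∑-quotient d β l)) ⟩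
        ι (a ℕ.+ b) * (x * (ι t * R))              ≈⟨ *-congˡ (x*yz≈y*xz _ _ _) ⟩
        ι (a ℕ.+ b) * (ι t * (x * R))              ≈⟨ *-assoc _ _ _ ⟨
        ι (a ℕ.+ b) * ι t * (x * R)                ≈⟨ *-congʳ (×1-homo-* (a ℕ.+ b) t) ⟨
        ι ((a ℕ.+ b) ℕ.* t) * (x * R)              ∎

    -- For each a exactly one b of degree d has difference zero, so each a is counted once.
    ∑-diagonal : ∀ d τ N → ∑ (vectors d) (λ v → ∑ (vectors d) (λ w →
        isZero (poly (d , v) -ᴾ poly (d , w)) * quotient τ N (poly (d , v)))) ≈ S d (τ ∷ []) (N ∷ [])
    ∑-diagonal d τ N = begin
      _ ≈⟨ ∑-cong (vectors d) (λ v → *-distribʳ-∑ _ (vectors d) _) ⟨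
      _ ≈⟨ ∑-cong (vectors d) (λ v → trans (*-congʳ (trans (∑-monic-difference d v isZero isZero-cong) (∑-isZero d))) (*-identityˡ _)) ⟩
      _ ≈⟨ S-single d τ N ⟨
      _ ∎

    product-formula : ∃ λ (f : SemiChar s → SemiChar s → ℕ → ℕ → Fin (suc p)) → ∀ d →
      S d (σ ∷ []) (suc m ∷ []) * S d (ψ ∷ []) (suc n ∷ []) - S d (σ ⊗ ψ ∷ []) (suc m ℕ.+ suc n ∷ []) ≈
      ∑ (cartesianProduct (factorizations (σ ⊗ ψ)) (positiveSplittings (suc m ℕ.+ suc n)))
        (λ ((α , β) , (i , j)) → residue (f α β i j) * S d (α ∷ β ∷ []) (i ∷ j ∷ []))
    product-formula with pointwiseExpansion
    ... | a , b , expansion = f , λ d → subtract (begin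
      S d (σ ∷ []) (suc m ∷ []) * S d (ψ ∷ []) (suc n ∷ [])
        ≈⟨ *-cong (S-single d σ (suc m)) (S-single d ψ (suc n)) ⟩
      _ ≈⟨ ∑-*-∑ (vectors d) (vectors d) _ _ ⟩
      _ ≈⟨ ∑-cong (vectors d) (λ v → ∑-cong (vectors d) (λ w → expansion (d , v) (d , w))) ⟩
      _ ≈⟨ ∑-cong (vectors d) (λ v → ∑-distrib-+ (vectors d) _ _) ⟩
      _ ≈⟨ ∑-distrib-+ (vectors d) _ _ ⟩
      _ ≈⟨ +-cong (∑-diagonal d (σ ⊗ ψ) (suc m ℕ.+ suc n)) (begin
             _ ≈⟨ ∑-cong (vectors d) (λ v → ∑-comm (vectors d) indices _) ⟩
             _ ≈⟨ ∑-comm (vectors d) indices _ ⟩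
             _ ≈⟨ ∑-cong indices (λ ((α , β) , (k , l)) → trans
                    (∑-term d α β k l (a ((α , β) , (k , l))) (b ((α , β) , (k , l))))
                    (*-congʳ (sym (residue-mod (coefficient α β k l))))) ⟩
             _ ≈⟨ ∑-cartesianProductWith _,_ (factorizations (σ ⊗ ψ)) (splittings (m ℕ.+ n)) _ ⟩
             _ ≈⟨ ∑-cong (factorizations (σ ⊗ ψ)) (λ αβ → ∑-positiveSplittings (m ℕ.+ n) (λ ij → summandAt d (αβ , ij))) ⟨
             -- Rewrites the total `suc (suc (m + n))`, in which the shift of exponents is stated,
             -- as `suc m + suc n`.
             _ ≈⟨ ∑-cong (factorizations (σ ⊗ ψ)) (λ αβ → reflexive (≡.cong
                    (λ N → ∑ (positiveSplittings (suc N)) (λ ij → summandAt d (αβ , ij))) (≡.sym (ℕ.+-suc m n)))) ⟩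
             _ ≈⟨ ∑-cartesianProductWith _,_ (factorizations (σ ⊗ ψ)) (positiveSplittings (suc m ℕ.+ suc n)) (summandAt d) ⟨
             _ ∎) ⟩
      _ ∎)
      where
      coefficient : SemiChar s → SemiChar s → ℕ → ℕ → ℕ
      coefficient α β k l = (a ((α , β) , (k , l)) ℕ.+ b ((α , β) , (k , l))) ℕ.* exponentSum β (suc l)

      -- `ℕ.pred` undoes the shift of the exponents. The values at i = 0 or j = 0 are arbitrary,
      -- since `positiveSplittings` contains no such pair.
      f : SemiChar s → SemiChar s → ℕ → ℕ → Fin (suc p)
      f α β i j = coefficient α β (ℕ.pred i) (ℕ.pred j) ℕ.mod suc p

      summandAt : ℕ → (SemiChar s × SemiChar s) × (ℕ × ℕ) → Carrier
      summandAt d ((α , β) , (i , j)) = residue (f α β i j) * S d (α ∷ β ∷ []) (i ∷ j ∷ [])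

      subtract : ∀ {x y z} → x ≈ y + z → x - y ≈ z
      subtract {x} {y} {z} x≈y+z = begin
        x - y          ≈⟨ +-congʳ (trans x≈y+z (+-comm y z)) ⟩
        z + y - y      ≈⟨ +-assoc z y _ ⟩
        z + (y - y)    ≈⟨ +-congˡ (-‿inverseʳ y) ⟩
        z + 0#         ≈⟨ +-identityʳ z ⟩
        z              ∎

open import Data.Nat.Base using (_+_; _^_; _≤_)

theorem9p2 :
    ∀ {c ℓ c′ ℓ′} (p q e : ℕ) → Prime p → q ≡ p ^ e →
    (F : Field c ℓ) (F-order : HasOrder F q)
    (L : Field c′ ℓ′) (ext : FieldExtension F L)
    (s : ℕ) (δ : Fin s → InjectiveLinearMap ext) (γ : InjectiveLinearMap ext)
    (σ ψ : SemiChar s) (m n : ℕ) → 1 ≤ m → 1 ≤ n →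
    let module L = Field L
        open PowerSums F-order ext δ γ
    in
    ∃ λ (f : SemiChar s → SemiChar s → ℕ → ℕ → Fin p) →
      ∀ (d : ℕ) →
        (S d (σ ∷ []) (m ∷ []) L.* S d (ψ ∷ []) (n ∷ [])) L.- S d (σ ⊗ ψ ∷ []) (m + n ∷ [])
          L.≈
        L.∑ (cartesianProduct (factorizations (σ ⊗ ψ)) (positiveSplittings (m + n)))
            (λ ((α , β) , (i , j)) →
              residue (f α β i j) L.* S d (α ∷ β ∷ []) (i ∷ j ∷ []))
theorem9p2 zero    q e p-prime q≡p^e = contradiction p-prime ¬prime[0]
theorem9p2 (suc p) q e p-prime ≡.refl F F-order L ext s δ γ σ ψ (suc m) (suc n) (s≤s z≤n) (s≤s z≤n) =
  Products.product-formula F F-order L ext δ γ p (ι-^-zero (suc p) e order·1≈0) σ ψ m n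
  where open FiniteField F F-order using (ι-^-zero; order·1≈0)
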